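{- Let $G$ be a finite simple group. (a) If $G$ is a normal complement to a subgroup $U$ in a group $\Gamma$, then every normal complement of $U$ in $\Gamma$ is isomorphic to $G$. (b) Hence if $E/k$ is a pre-Galois extension for which the simple group $G$ is a pre-Galois group, then every pre-Galois group of $E/k$ is isomorphic to $G$.
   Context: A subgroup $V$ is a complement of a subgroup $U$ in $\Gamma$ if every element of $\Gamma$ can be uniquely written as $vu$ with $v\in V$, $u\in U$; it is a normal complement if moreover $V$ is normal in $\Gamma$. A finite field extension $E/k$ is pre-Galois, with pre-Galois group $G$, if there is a finite Galois extension $L/k$ such that $E\otimes_kL$ is a Galois field extension of $L$ with Galois group $G$ (different choices of $L$ may give different groups). -}

module Defs where

open import Algebra.Bundles using (Group; AbelianGroup; CommutativeRing)
import Algebra.Definitions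
import Algebra.Morphism.Construct.Composition as Compose
import Algebra.Morphism.Construct.Identity as Identity
open import Algebra.Morphism.Structures
  using (IsGroupIsomorphism; IsRingHomomorphism; IsRingIsomorphism)
import Algebra.Properties.AbelianGroup
import Algebra.Properties.Monoid.Sum
open import Data.Fin.Base using (Fin)
open import Data.Product.Base using (Σ; Σ-syntax; ∃-syntax; _×_; _,_; proj₁; proj₂)
open import Data.Sum.Base using (_⊎_)
open import Function.Base using (id)
open import Function.Bundles using (Inverse)
open import Level using (Level; suc)
import Relation.Binary.PropositionalEquality as ≡
import Relation.Binary.Reasoning.Setoid
open import Relation.Nullary.Negation using (¬_)
open import Relation.Unary using (Pred; _∈_)

module _ {ℓ : Level} where

  infix 4 _≅_

  _≅_ : Group ℓ ℓ → Group ℓ ℓ → Set ℓ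
  G ≅ H = ∃[ f ] IsGroupIsomorphism (Group.rawGroup G) (Group.rawGroup H) f

  record Subgroup (Γ : Group ℓ ℓ) : Set (suc ℓ) where
    open Group Γ
    field
      member    : Pred Carrier ℓ
      resp      : ∀ {x y} → x ≈ y → x ∈ member → y ∈ member
      ε-closed  : ε ∈ member
      ∙-closed  : ∀ {x y} → x ∈ member → y ∈ member → (x ∙ y) ∈ member
      ⁻¹-closed : ∀ {x} → x ∈ member → (x ⁻¹) ∈ member

    group : Group ℓ ℓ
    group = record
      { Carrier = Σ Carrier member
      ; _≈_     = λ x y → proj₁ x ≈ proj₁ y
      ; _∙_     = λ x y → (proj₁ x ∙ proj₁ y) , ∙-closed (proj₂ x) (proj₂ y)
      ; ε       = ε , ε-closed
      ; _⁻¹     = λ x → (proj₁ x ⁻¹) , ⁻¹-closed (proj₂ x)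
      ; isGroup = record
        { isMonoid = record
          { isSemigroup = record
            { isMagma = record
              { isEquivalence = record { refl = refl ; sym = sym ; trans = trans }
              ; ∙-cong        = ∙-cong
              }
            ; assoc = λ x y z → assoc (proj₁ x) (proj₁ y) (proj₁ z)
            }
          ; identity = (λ x → identityˡ (proj₁ x)) , (λ x → identityʳ (proj₁ x))
          }
        ; inverse = (λ x → inverseˡ (proj₁ x)) , (λ x → inverseʳ (proj₁ x))
        ; ⁻¹-cong = ⁻¹-cong
        }
      }

  module _ {Γ : Group ℓ ℓ} where
    open Group Γ
    open Subgroup using (member)

    IsNormal : Subgroup Γ → Set ℓ
    IsNormal N = ∀ g {x} → x ∈ member N → ((g ∙ x) ∙ g ⁻¹) ∈ member N

    -- The second argument V is the complement; products are taken in the order v ∙ u.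
    IsComplement : Subgroup Γ → Subgroup Γ → Set ℓ
    IsComplement U V =
      (∀ g → ∃[ v ] ∃[ u ] v ∈ member V × u ∈ member U × g ≈ v ∙ u) ×
      (∀ {v v′ u u′} → v ∈ member V → v′ ∈ member V → u ∈ member U → u′ ∈ member U →
        v ∙ u ≈ v′ ∙ u′ → v ≈ v′ × u ≈ u′)

    IsNormalComplement : Subgroup Γ → Subgroup Γ → Set ℓ
    IsNormalComplement U V = IsComplement U V × IsNormal V

  IsFinite : Group ℓ ℓ → Set ℓ
  IsFinite G = ∃[ n ] Inverse (Group.setoid G) (≡.setoid (Fin n))

  -- Stated with a disjunction, as classically; without excluded middle no
  -- group could be shown to satisfy it.
  IsSimple : Group ℓ ℓ → Set (suc ℓ)
  IsSimple G =
    (∃[ g ] ¬ (g ≈ ε)) ×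
    (∀ (N : Subgroup G) → IsNormal N →
      (∀ g → g ∈ Subgroup.member N → g ≈ ε) ⊎ (∀ g → g ∈ Subgroup.member N))
    where open Group G

module _ {ℓ : Level} where

  IsField : CommutativeRing ℓ ℓ → Set ℓ
  IsField R = ¬ (0# ≈ 1#) × (∀ x → ¬ (x ≈ 0#) → Invertible 1# _*_ x)
    where
    open CommutativeRing R
    open Algebra.Definitions _≈_ using (Invertible)

  record Algebra (k : CommutativeRing ℓ ℓ) : Set (suc ℓ) where
    field
      commutativeRing    : CommutativeRing ℓ ℓ
      ι                  : CommutativeRing.Carrier k → CommutativeRing.Carrier commutativeRing
      isRingHomomorphism :
        IsRingHomomorphism (CommutativeRing.rawRing k) (CommutativeRing.rawRing commutativeRing) ι

    open CommutativeRing commutativeRing public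

  module _ {k : CommutativeRing ℓ ℓ} where
    private module k = CommutativeRing k

    -- A finite k-basis e: every element has unique coordinates.
    IsFiniteDimensional : Algebra k → Set ℓ
    IsFiniteDimensional A =
      ∃[ n ] Σ[ e ∈ (Fin n → Carrier) ]
        (∀ x → ∃[ c ] x ≈ combination e c) ×
        (∀ c d → combination e c ≈ combination e d → ∀ i → c i k.≈ d i)
      where
      open Algebra A
      open Algebra.Properties.Monoid.Sum +-monoid using (sum)

      combination : ∀ {n} → (Fin n → Carrier) → (Fin n → k.Carrier) → Carrier
      combination e c = sum (λ i → ι (c i) * e i)

    record IsFiniteFieldExtension (E : Algebra k) : Set ℓ where
      field
        base-isField        : IsField k
        isField             : IsField (Algebra.commutativeRing E)
        isFiniteDimensional : IsFiniteDimensional E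

    record Automorphism (A : Algebra k) : Set ℓ where
      open Algebra A
      field
        ⟦_⟧                : Carrier → Carrier
        isRingIsomorphism  : IsRingIsomorphism rawRing rawRing ⟦_⟧
        fixes-base         : ∀ c → ⟦ ι c ⟧ ≈ ι c

      open IsRingIsomorphism isRingIsomorphism public

    Aut : Algebra k → Group ℓ ℓ
    Aut A = record
      { Carrier = Automorphism A
      ; _≈_     = λ σ τ → ∀ x → σ ⟨ x ⟩ ≈ τ ⟨ x ⟩
      ; _∙_     = compose
      ; ε       = identity
      ; _⁻¹     = invert
      ; isGroup = record
        { isMonoid = record
          { isSemigroup = record
            { isMagma = record
              { isEquivalence = record
                { refl  = λ x → refl
                ; sym   = λ p x → sym (p x)
                ; trans = λ p q x → trans (p x) (q x)
                }
              ; ∙-cong = λ {σ} {σ′} {τ} {τ′} p q x →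
                  trans (⟦⟧-cong σ (q x)) (p (τ′ ⟨ x ⟩))
              }
            ; assoc = λ σ τ υ x → refl
            }
          ; identity = (λ σ x → refl) , (λ σ x → refl)
          }
        ; inverse = invertˡ , section
        ; ⁻¹-cong = λ {σ} {τ} p x → injective σ
            (trans (section σ x)
              (trans (sym (section τ x)) (sym (p (invert τ ⟨ x ⟩)))))
        }
      }
      where
      open Algebra A
      open Automorphism using (⟦⟧-cong; injective; surjective; isRingIsomorphism; fixes-base)

      infix 20 _⟨_⟩
      _⟨_⟩ : Automorphism A → Carrier → Carrier
      _⟨_⟩ = Automorphism.⟦_⟧

      module _ (σ : Automorphism A) where
        private module σ = Automorphism σ

        pre : Carrier → Carrier
        pre y = proj₁ (σ.surjective y)

        pre-section : ∀ y → σ ⟨ pre y ⟩ ≈ y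
        pre-section y = proj₂ (σ.surjective y) refl

        pre-unique : ∀ {x y} → σ ⟨ x ⟩ ≈ y → pre y ≈ x
        pre-unique {x} {y} p = σ.injective (trans (pre-section y) (sym p))

        invert : Automorphism A
        invert = record
          { ⟦_⟧ = pre
          ; isRingIsomorphism = record
            { isRingMonomorphism = record
              { isRingHomomorphism = record
                { isSemiringHomomorphism = record
                  { isNearSemiringHomomorphism = record
                    { +-isMonoidHomomorphism = record
                      { isMagmaHomomorphism = record
                        { isRelHomomorphism = record
                          { cong = λ {x} {y} p → pre-unique (trans (pre-section y) (sym p)) }
                        ; homo = λ x y → pre-unique
                            (trans (σ.+-homo _ _) (+-cong (pre-section x) (pre-section y)))
                        }
                      ; ε-homo = pre-unique σ.0#-homo
                      }
                    ; *-homo = λ x y → pre-unique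
                        (trans (σ.*-homo _ _) (*-cong (pre-section x) (pre-section y)))
                    }
                  ; 1#-homo = pre-unique σ.1#-homo
                  }
                ; -‿homo = λ x → pre-unique (trans (σ.-‿homo _) (-‿cong (pre-section x)))
                }
              ; injective = λ {x} {y} p →
                  trans (sym (pre-section x)) (trans (σ.⟦⟧-cong p) (pre-section y))
              }
            ; surjective = λ y → σ ⟨ y ⟩ , λ p → pre-unique (sym p)
            }
          ; fixes-base = λ c → pre-unique (σ.fixes-base c)
          }

        section : ∀ y → σ ⟨ invert ⟨ y ⟩ ⟩ ≈ y
        section = pre-section

        invertˡ : ∀ x → invert ⟨ σ ⟨ x ⟩ ⟩ ≈ x
        invertˡ x = pre-unique refl

      identity : Automorphism A
      identity = record
        { ⟦_⟧               = id
        ; isRingIsomorphism = Identity.isRingIsomorphism rawRing refl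
        ; fixes-base        = λ c → refl
        }

      compose : Automorphism A → Automorphism A → Automorphism A
      compose σ τ = record
        { ⟦_⟧               = λ x → σ ⟨ τ ⟨ x ⟩ ⟩
        ; isRingIsomorphism =
            Compose.isRingIsomorphism trans (isRingIsomorphism τ) (isRingIsomorphism σ)
        ; fixes-base        = λ c → trans (⟦⟧-cong σ (fixes-base τ c)) (fixes-base σ c)
        }

    -- Finite Galois extensions in Artin's sense: [E : k] is finite and the
    -- fixed field of Aut(E/k) is k.
    record IsGaloisExtension (E : Algebra k) : Set ℓ where
      open Algebra E
      field
        isFiniteFieldExtension : IsFiniteFieldExtension E
        fixed-by-all⇒base :
          ∀ x → (∀ (σ : Automorphism E) → Automorphism.⟦_⟧ σ x ≈ x) → ∃[ c ] x ≈ ι c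

module TensorProduct {ℓ : Level} {k : CommutativeRing ℓ ℓ} (A B : Algebra k) where
  private
    module k = CommutativeRing k
    module A = Algebra A
    module B = Algebra B

  infix  4 _∼_
  infixl 6 _⊕_
  infixl 7 _⊗_ _·_

  data Tensor : Set ℓ where
    _⊗_ : A.Carrier → B.Carrier → Tensor
    𝟎   : Tensor
    _⊕_ : Tensor → Tensor → Tensor
    ⊖_  : Tensor → Tensor

  -- The quotient of the free abelian group on A × B by the relations making
  -- _⊗_ biadditive and k-balanced.
  data _∼_ : Tensor → Tensor → Set ℓ where
    ∼-refl    : ∀ {x} → x ∼ x
    ∼-sym     : ∀ {x y} → x ∼ y → y ∼ x
    ∼-trans   : ∀ {x y z} → x ∼ y → y ∼ z → x ∼ z
    ⊕-cong    : ∀ {x x′ y y′} → x ∼ x′ → y ∼ y′ → x ⊕ y ∼ x′ ⊕ y′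
    ⊖-cong    : ∀ {x x′} → x ∼ x′ → ⊖ x ∼ ⊖ x′
    ⊕-assoc   : ∀ x y z → (x ⊕ y) ⊕ z ∼ x ⊕ (y ⊕ z)
    ⊕-comm    : ∀ x y → x ⊕ y ∼ y ⊕ x
    ⊕-idˡ     : ∀ x → 𝟎 ⊕ x ∼ x
    ⊕-invˡ    : ∀ x → (⊖ x) ⊕ x ∼ 𝟎
    ⊗-cong    : ∀ {a a′ b b′} → a A.≈ a′ → b B.≈ b′ → a ⊗ b ∼ a′ ⊗ b′
    ⊗-addˡ    : ∀ a a′ b → (a A.+ a′) ⊗ b ∼ a ⊗ b ⊕ a′ ⊗ b
    ⊗-addʳ    : ∀ a b b′ → a ⊗ (b B.+ b′) ∼ a ⊗ b ⊕ a ⊗ b′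
    ⊗-balance : ∀ c a b → (A.ι c A.* a) ⊗ b ∼ a ⊗ (B.ι c B.* b)

  ⊕-abelianGroup : AbelianGroup ℓ ℓ
  ⊕-abelianGroup = record
    { Carrier = Tensor
    ; _≈_     = _∼_
    ; _∙_     = _⊕_
    ; ε       = 𝟎
    ; _⁻¹     = ⊖_
    ; isAbelianGroup = record
      { isGroup = record
        { isMonoid = record
          { isSemigroup = record
            { isMagma = record
              { isEquivalence = record { refl = ∼-refl ; sym = ∼-sym ; trans = ∼-trans }
              ; ∙-cong        = ⊕-cong
              }
            ; assoc = ⊕-assoc
            }
          ; identity = ⊕-idˡ , λ x → ∼-trans (⊕-comm x 𝟎) (⊕-idˡ x)
          }
        ; inverse = ⊕-invˡ , λ x → ∼-trans (⊕-comm x (⊖ x)) (⊕-invˡ x)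
        ; ⁻¹-cong = ⊖-cong
        }
      ; comm = ⊕-comm
      }
    }

  private
    module ⊕ = AbelianGroup ⊕-abelianGroup
    open Algebra.Properties.AbelianGroup ⊕-abelianGroup
      using (ε⁻¹≈ε; ⁻¹-∙-comm)
    open Relation.Binary.Reasoning.Setoid ⊕.setoid

    ⊕-swap : ∀ x y z w → (x ⊕ y) ⊕ (z ⊕ w) ∼ (x ⊕ z) ⊕ (y ⊕ w)
    ⊕-swap x y z w = begin
      (x ⊕ y) ⊕ (z ⊕ w) ≈⟨ ⊕-assoc x y (z ⊕ w) ⟩
      x ⊕ (y ⊕ (z ⊕ w)) ≈⟨ ⊕-cong ∼-refl (⊕-assoc y z w) ⟨
      x ⊕ ((y ⊕ z) ⊕ w) ≈⟨ ⊕-cong ∼-refl (⊕-cong (⊕-comm y z) ∼-refl) ⟩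
      x ⊕ ((z ⊕ y) ⊕ w) ≈⟨ ⊕-cong ∼-refl (⊕-assoc z y w) ⟩
      x ⊕ (z ⊕ (y ⊕ w)) ≈⟨ ⊕-assoc x z (y ⊕ w) ⟨
      (x ⊕ z) ⊕ (y ⊕ w) ∎

  scale : A.Carrier → B.Carrier → Tensor → Tensor
  scale a b (c ⊗ d) = (a A.* c) ⊗ (b B.* d)
  scale a b 𝟎       = 𝟎
  scale a b (x ⊕ y) = scale a b x ⊕ scale a b y
  scale a b (⊖ x)   = ⊖ scale a b x

  _·_ : Tensor → Tensor → Tensor
  (a ⊗ b) · y = scale a b y
  𝟎       · y = 𝟎
  (x ⊕ z) · y = x · y ⊕ z · y
  (⊖ x)   · y = ⊖ (x · y)

  private
    A-swap : ∀ a c x → a A.* (c A.* x) A.≈ c A.* (a A.* x)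
    A-swap a c x = A.trans (A.sym (A.*-assoc a c x))
      (A.trans (A.*-congʳ (A.*-comm a c)) (A.*-assoc c a x))

    B-swap : ∀ a c x → a B.* (c B.* x) B.≈ c B.* (a B.* x)
    B-swap a c x = B.trans (B.sym (B.*-assoc a c x))
      (B.trans (B.*-congʳ (B.*-comm a c)) (B.*-assoc c a x))

    scale-cong : ∀ a b {x y} → x ∼ y → scale a b x ∼ scale a b y
    scale-cong a b ∼-refl            = ∼-refl
    scale-cong a b (∼-sym p)         = ∼-sym (scale-cong a b p)
    scale-cong a b (∼-trans p q)     = ∼-trans (scale-cong a b p) (scale-cong a b q)
    scale-cong a b (⊕-cong p q)      = ⊕-cong (scale-cong a b p) (scale-cong a b q)
    scale-cong a b (⊖-cong p)        = ⊖-cong (scale-cong a b p)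
    scale-cong a b (⊕-assoc x y z)   = ⊕-assoc _ _ _
    scale-cong a b (⊕-comm x y)      = ⊕-comm _ _
    scale-cong a b (⊕-idˡ x)         = ⊕-idˡ _
    scale-cong a b (⊕-invˡ x)        = ⊕-invˡ _
    scale-cong a b (⊗-cong p q)      = ⊗-cong (A.*-congˡ p) (B.*-congˡ q)
    scale-cong a b (⊗-addˡ c c′ d)   =
      ∼-trans (⊗-cong (A.distribˡ a c c′) B.refl) (⊗-addˡ _ _ _)
    scale-cong a b (⊗-addʳ c d d′)   =
      ∼-trans (⊗-cong A.refl (B.distribˡ b d d′)) (⊗-addʳ _ _ _)
    scale-cong a b (⊗-balance r c d) =
      ∼-trans (⊗-cong (A-swap a (A.ι r) c) B.refl)
        (∼-trans (⊗-balance r _ _) (⊗-cong A.refl (B-swap (B.ι r) b d)))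

    ·-congˡ : ∀ x {y z} → y ∼ z → x · y ∼ x · z
    ·-congˡ (a ⊗ b) p = scale-cong a b p
    ·-congˡ 𝟎       p = ∼-refl
    ·-congˡ (x ⊕ w) p = ⊕-cong (·-congˡ x p) (·-congˡ w p)
    ·-congˡ (⊖ x)   p = ⊖-cong (·-congˡ x p)

    ·-zeroʳ : ∀ x → x · 𝟎 ∼ 𝟎
    ·-zeroʳ (a ⊗ b) = ∼-refl
    ·-zeroʳ 𝟎       = ∼-refl
    ·-zeroʳ (x ⊕ y) = ∼-trans (⊕-cong (·-zeroʳ x) (·-zeroʳ y)) (⊕-idˡ 𝟎)
    ·-zeroʳ (⊖ x)   = ∼-trans (⊖-cong (·-zeroʳ x)) ε⁻¹≈ε

    ·-distribˡ : ∀ x y z → x · (y ⊕ z) ∼ x · y ⊕ x · z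
    ·-distribˡ (a ⊗ b) y z = ∼-refl
    ·-distribˡ 𝟎       y z = ∼-sym (⊕-idˡ 𝟎)
    ·-distribˡ (x ⊕ w) y z =
      ∼-trans (⊕-cong (·-distribˡ x y z) (·-distribˡ w y z)) (⊕-swap _ _ _ _)
    ·-distribˡ (⊖ x)   y z =
      ∼-trans (⊖-cong (·-distribˡ x y z)) (∼-sym (⁻¹-∙-comm _ _))

    ·-⊖ʳ : ∀ x y → x · (⊖ y) ∼ ⊖ (x · y)
    ·-⊖ʳ (a ⊗ b) y = ∼-refl
    ·-⊖ʳ 𝟎       y = ∼-sym ε⁻¹≈ε
    ·-⊖ʳ (x ⊕ w) y = ∼-trans (⊕-cong (·-⊖ʳ x y) (·-⊖ʳ w y)) (⁻¹-∙-comm _ _)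
    ·-⊖ʳ (⊖ x)   y = ⊖-cong (·-⊖ʳ x y)

    ·-comm : ∀ x y → x · y ∼ y · x
    ·-comm (a ⊗ b) (c ⊗ d) = ⊗-cong (A.*-comm a c) (B.*-comm b d)
    ·-comm (a ⊗ b) 𝟎       = ∼-refl
    ·-comm (a ⊗ b) (y ⊕ z) = ⊕-cong (·-comm (a ⊗ b) y) (·-comm (a ⊗ b) z)
    ·-comm (a ⊗ b) (⊖ y)   = ⊖-cong (·-comm (a ⊗ b) y)
    ·-comm 𝟎       y       = ∼-sym (·-zeroʳ y)
    ·-comm (x ⊕ w) y       =
      ∼-trans (⊕-cong (·-comm x y) (·-comm w y)) (∼-sym (·-distribˡ y x w))
    ·-comm (⊖ x)   y       = ∼-trans (⊖-cong (·-comm x y)) (∼-sym (·-⊖ʳ y x))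

    ·-cong : ∀ {x x′ y y′} → x ∼ x′ → y ∼ y′ → x · y ∼ x′ · y′
    ·-cong {x} {x′} {y} {y′} p q = begin
      x  · y  ≈⟨ ·-congˡ x q ⟩
      x  · y′ ≈⟨ ·-comm x y′ ⟩
      y′ · x  ≈⟨ ·-congˡ y′ p ⟩
      y′ · x′ ≈⟨ ·-comm y′ x′ ⟩
      x′ · y′ ∎

    ·-assoc : ∀ x y z → (x · y) · z ∼ x · (y · z)
    ·-assoc (a ⊗ b) (c ⊗ d) (e ⊗ f) = ⊗-cong (A.*-assoc a c e) (B.*-assoc b d f)
    ·-assoc (a ⊗ b) (c ⊗ d) 𝟎       = ∼-refl
    ·-assoc (a ⊗ b) (c ⊗ d) (z ⊕ w) =
      ⊕-cong (·-assoc (a ⊗ b) (c ⊗ d) z) (·-assoc (a ⊗ b) (c ⊗ d) w)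
    ·-assoc (a ⊗ b) (c ⊗ d) (⊖ z)   = ⊖-cong (·-assoc (a ⊗ b) (c ⊗ d) z)
    ·-assoc (a ⊗ b) 𝟎       z       = ∼-refl
    ·-assoc (a ⊗ b) (y ⊕ w) z       = ⊕-cong (·-assoc (a ⊗ b) y z) (·-assoc (a ⊗ b) w z)
    ·-assoc (a ⊗ b) (⊖ y)   z       = ⊖-cong (·-assoc (a ⊗ b) y z)
    ·-assoc 𝟎       y       z       = ∼-refl
    ·-assoc (x ⊕ w) y       z       = ⊕-cong (·-assoc x y z) (·-assoc w y z)
    ·-assoc (⊖ x)   y       z       = ⊖-cong (·-assoc x y z)

    ·-idˡ : ∀ x → (A.1# ⊗ B.1#) · x ∼ x
    ·-idˡ (a ⊗ b) = ⊗-cong (A.*-identityˡ a) (B.*-identityˡ b)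
    ·-idˡ 𝟎       = ∼-refl
    ·-idˡ (x ⊕ y) = ⊕-cong (·-idˡ x) (·-idˡ y)
    ·-idˡ (⊖ x)   = ⊖-cong (·-idˡ x)

  ⊗-ring : CommutativeRing ℓ ℓ
  ⊗-ring = record
    { Carrier = Tensor
    ; _≈_     = _∼_
    ; _+_     = _⊕_
    ; _*_     = _·_
    ; -_      = ⊖_
    ; 0#      = 𝟎
    ; 1#      = A.1# ⊗ B.1#
    ; isCommutativeRing = record
      { isRing = record
        { +-isAbelianGroup = ⊕.isAbelianGroup
        ; *-cong           = ·-cong
        ; *-assoc          = ·-assoc
        ; *-identity       = ·-idˡ , λ x → ∼-trans (·-comm x _) (·-idˡ x)
        ; distrib          = ·-distribˡ , λ x y z → ∼-refl
        }
      ; *-comm = ·-comm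
      }
    }

  -- A ⊗ₖ B as an algebra over its second factor, via b ↦ 1 ⊗ b.
  ⊗-algebraʳ : Algebra B.commutativeRing
  ⊗-algebraʳ = record
    { commutativeRing = ⊗-ring
    ; ι    = A.1# ⊗_
    ; isRingHomomorphism = record
      { isSemiringHomomorphism = record
        { isNearSemiringHomomorphism = record
          { +-isMonoidHomomorphism = record
            { isMagmaHomomorphism = record
              { isRelHomomorphism = record { cong = ⊗-cong A.refl }
              ; homo              = ⊗-addʳ A.1#
              }
            ; ε-homo = 1⊗0
            }
          ; *-homo = λ b b′ → ⊗-cong (A.sym (A.*-identityˡ A.1#)) B.refl
          }
        ; 1#-homo = ∼-refl
        }
      ; -‿homo = λ b → inverseˡ-unique _ _
          (∼-trans (∼-sym (⊗-addʳ A.1# (B.- b) b))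
            (∼-trans (⊗-cong A.refl (B.-‿inverseˡ b)) 1⊗0))
      }
    }
    where
    open Algebra.Properties.AbelianGroup ⊕-abelianGroup
      using (identityˡ-unique; inverseˡ-unique)

    1⊗0 : A.1# ⊗ B.0# ∼ 𝟎
    1⊗0 = identityˡ-unique _ _
      (∼-trans (∼-sym (⊗-addʳ A.1# B.0# B.0#)) (⊗-cong A.refl (B.+-identityˡ B.0#)))

module _ {ℓ : Level} {k : CommutativeRing ℓ ℓ} where

  record IsPreGaloisGroup (E : Algebra k) (G : Group ℓ ℓ) : Set (suc ℓ) where
    open TensorProduct E using (⊗-algebraʳ)
    field
      isFiniteFieldExtension : IsFiniteFieldExtension E
      L                      : Algebra k
      L-isGalois             : IsGaloisExtension L
      E⊗L-isGalois           : IsGaloisExtension (⊗-algebraʳ L)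
      Aut≅G                  : Aut (⊗-algebraʳ L) ≅ G

module Submission where

open import Algebra.Bundles using (AbelianGroup; CommutativeMonoid; CommutativeRing; Group)
import Algebra.Definitions.RawMonoid
import Algebra.Morphism.Construct.Composition as Compose
import Algebra.Morphism.Construct.Identity as Identity
open import Algebra.Morphism.Structures using (IsGroupIsomorphism; IsRingHomomorphism)
import Algebra.Properties.AbelianGroup
import Algebra.Properties.CommutativeSemigroup
import Algebra.Properties.Group
import Algebra.Properties.Ring
import Algebra.Properties.Semiring.Sum
open import Axiom.ExcludedMiddle using (ExcludedMiddle)
open import Data.Empty using (⊥; ⊥-elim)
open import Data.Fin.Base using (zero; suc)
open import Data.List.Base using (List; []; _∷_)
open import Data.List.Relation.Unary.All as All using (All; []; _∷_)
open import Data.Nat.Base using (zero; suc)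
open import Data.Product.Base using (Σ-syntax; ∃-syntax; _×_; _,_; proj₁; proj₂)
open import Data.Sum.Base using (_⊎_; inj₁; inj₂)
open import Data.Vec.Functional as Vec using (Vector; removeAt)
open import Function.Base using (_∘_; id)
open import Level using (Level) renaming (suc to sucℓ)
open import Relation.Binary.Bundles using (Setoid)
import Relation.Binary.Reasoning.Setoid
open import Relation.Nullary.Decidable.Core using (Dec; yes; no; decidable-stable)
open import Relation.Nullary.Negation using (¬_; contradiction)
open import Relation.Unary using (_∈_)
open import Defs

-- Let N, N′ be normal complements of U, with N simple. Both act simply
-- transitively on Γ/U and normalize each other, and these two properties
-- already force N ≅ N′: either N ∩ N′ = N, and N = N′, or N and N′ commute.
--
-- For (b) choose a field Ω in which E, L and L′ embed. The pre-Galois groups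
-- Aut_L(E ⊗ L) and Aut_L′(E ⊗ L′) act simply transitively on Hom_k(E, Ω), and
-- they normalize each other because L and L′ are normal over k. No common
-- Galois extension is needed: an automorphism extending g is replaced by a pair
-- of embeddings of Ω into a larger field.

-- Simply transitive actions

-- In (b) the set Hom_k(E, Ω) plays the role of Γ/U, so the two parts share one statement about
-- actions and no ambient Galois group Γ has to be built.
--
-- Galois means here only that the degree is finite and the fixed field is the base; no polynomials
-- are at hand. The single fact needed about such an extension M is that any two embeddings of M
-- into a field differ by an automorphism of M. It comes from M ⊗ M, where the maps x ⊗ y ↦ σ(x) y
-- jointly separate points. It is used three times: it makes Aut_L(E ⊗ L) transitive, because
-- embeddings of E correspond to L-embeddings of E ⊗ L; it is the normality of L′, giving σ with αl′
-- = βl′σ; and it gives the h with αf′g′ = βf′h(1 ⊗ σ).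
--
-- Fields containing given ones are residue fields of tensor products. The tensor products are
-- finite over a field, so dividing out nonzero nonunits must stop. Nothing makes Ω normal over E ⊗
-- L, hence g need not extend to an automorphism of Ω; this is what forces the pair of embeddings
-- into a larger field.

module _ {ℓ : Level} (G H : Group ℓ ℓ) where
  private
    module G = Group G
    module H = Group H
  open Algebra.Properties.Group H using (inverseˡ-unique; identityˡ-unique)

  bijectiveHomo⇒≅ :
    (f : G.Carrier → H.Carrier) →
    (∀ {x y} → x G.≈ y → f x H.≈ f y) →
    (∀ x y → f (x G.∙ y) H.≈ f x H.∙ f y) →
    (∀ {x y} → f x H.≈ f y → x G.≈ y) →
    (∀ y → ∃[ x ] f x H.≈ y) →
    G ≅ H
  bijectiveHomo⇒≅ f cong homo inj surj = f , record
    { isGroupMonomorphism = record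
      { isGroupHomomorphism = record
        { isMonoidHomomorphism = record
          { isMagmaHomomorphism = record
            { isRelHomomorphism = record { cong = cong }
            ; homo              = homo
            }
          ; ε-homo = ε-homo
          }
        ; ⁻¹-homo = λ x → inverseˡ-unique _ _
            (H.trans (H.sym (homo _ x)) (H.trans (cong (G.inverseˡ x)) ε-homo))
        }
      ; injective = inj
      }
    ; surjective = λ y → proj₁ (surj y) , λ z≈x → H.trans (cong z≈x) (proj₂ (surj y))
    }
    where
    ε-homo : f G.ε H.≈ H.ε
    ε-homo = identityˡ-unique _ _ (H.trans (H.sym (homo G.ε G.ε)) (cong (G.identityˡ G.ε)))

module _ {ℓ : Level} where

  ≅-sym : ∀ (G H : Group ℓ ℓ) → G ≅ H → H ≅ G
  ≅-sym G H (f , f-iso) = bijectiveHomo⇒≅ H G f⁻¹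
    (λ {x} {y} p → injective (H.trans (f∘f⁻¹ x) (H.trans p (H.sym (f∘f⁻¹ y)))))
    (λ x y → injective (H.trans (f∘f⁻¹ _)
      (H.sym (H.trans (∙-homo _ _) (H.∙-cong (f∘f⁻¹ x) (f∘f⁻¹ y))))))
    (λ {x} {y} p → H.trans (H.sym (f∘f⁻¹ x)) (H.trans (⟦⟧-cong p) (f∘f⁻¹ y)))
    (λ x → f x , injective (f∘f⁻¹ (f x)))
    where
    module G = Group G
    module H = Group H
    open IsGroupIsomorphism f-iso using (injective; surjective; ∙-homo; ⟦⟧-cong)

    f⁻¹ : H.Carrier → G.Carrier
    f⁻¹ y = proj₁ (surjective y)

    f∘f⁻¹ : ∀ y → f (f⁻¹ y) H.≈ y
    f∘f⁻¹ y = proj₂ (surjective y) G.refl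

  ≅-trans : ∀ (G H K : Group ℓ ℓ) → G ≅ H → H ≅ K → G ≅ K
  ≅-trans G H K (f , f-iso) (g , g-iso) =
    _ , Compose.isGroupIsomorphism (Group.trans K) f-iso g-iso

  IsSimple-resp-≅ : ∀ (G H : Group ℓ ℓ) → G ≅ H → IsSimple G → IsSimple H
  IsSimple-resp-≅ G H (f , f-iso) ((g , g≉ε) , normal⇒trivial⊎full) =
    (f g , λ p → g≉ε (injective (H.trans p (H.sym ε-homo)))) , dichotomy
    where
    module G = Group G
    module H = Group H
    open IsGroupIsomorphism f-iso

    f⁻¹ : ∀ y → ∃[ x ] f x H.≈ y
    f⁻¹ y = proj₁ (surjective y) , proj₂ (surjective y) G.refl

    module _ (N : Subgroup H) (N-normal : IsNormal N) where
      open Subgroup N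

      preimage : Subgroup G
      preimage = record
        { member    = λ x → f x ∈ member
        ; resp      = λ p → resp (⟦⟧-cong p)
        ; ε-closed  = resp (H.sym ε-homo) ε-closed
        ; ∙-closed  = λ p q → resp (H.sym (∙-homo _ _)) (∙-closed p q)
        ; ⁻¹-closed = λ p → resp (H.sym (⁻¹-homo _)) (⁻¹-closed p)
        }

      preimage-normal : IsNormal preimage
      preimage-normal x {y} p =
        resp (H.sym (H.trans (∙-homo _ _) (H.∙-cong (∙-homo x y) (⁻¹-homo x))))
          (N-normal (f x) p)

      dichotomy : (∀ h → h ∈ member → h H.≈ H.ε) ⊎ (∀ h → h ∈ member)
      dichotomy with normal⇒trivial⊎full preimage preimage-normal
      ... | inj₁ trivial = inj₁ λ h h∈N →
        let (x , fx≈h) = f⁻¹ h in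
        H.trans (H.sym fx≈h)
          (H.trans (⟦⟧-cong (trivial x (resp (H.sym fx≈h) h∈N))) ε-homo)
      ... | inj₂ full = inj₂ λ h →
        let (x , fx≈h) = f⁻¹ h in resp fx≈h (full x)

record SimplyTransitiveAction {ℓ : Level} (G : Group ℓ ℓ) (X : Setoid ℓ ℓ) : Set ℓ where
  private
    module G = Group G
    module X = Setoid X
  infixr 7 _•_
  field
    _•_        : G.Carrier → X.Carrier → X.Carrier
    •-cong     : ∀ {g h x y} → g G.≈ h → x X.≈ y → (g • x) X.≈ (h • y)
    •-assoc    : ∀ g h x → ((g G.∙ h) • x) X.≈ (g • h • x)
    transitive : ∀ x y → ∃[ g ] (g • x) X.≈ y
    free       : ∀ {g h} x → (g • x) X.≈ (h • x) → g G.≈ h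

  -- A translation x ↦ ε • x is onto by transitivity, hence the identity.
  •-identity : ∀ x → (G.ε • x) X.≈ x
  •-identity x with transitive x x
  ... | g , gx≈x = X.trans (•-cong (G.sym g≈ε) X.refl) gx≈x
    where
    open Algebra.Properties.Group G using (identityˡ-unique)
    g≈ε : g G.≈ G.ε
    g≈ε = identityˡ-unique g g
      (free x (X.trans (•-assoc g g x) (•-cong G.refl gx≈x)))

  •-inverseˡ : ∀ g x → (g G.⁻¹ • g • x) X.≈ x
  •-inverseˡ g x =
    X.trans (X.sym (•-assoc _ g x)) (X.trans (•-cong (G.inverseˡ g) X.refl) (•-identity x))

  •-inverseʳ : ∀ g x → (g • g G.⁻¹ • x) X.≈ x
  •-inverseʳ g x =
    X.trans (X.sym (•-assoc g _ x)) (X.trans (•-cong (G.inverseʳ g) X.refl) (•-identity x))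

module _ {ℓ : Level} {G H : Group ℓ ℓ} {X : Setoid ℓ ℓ} where
  private
    module G = Group G
    module H = Group H
    module X = Setoid X

  -- As permutations of X this says g h g⁻¹ = h′, with h′ independent of x.
  Normalizes : SimplyTransitiveAction G X → SimplyTransitiveAction H X → Set ℓ
  Normalizes α β = ∀ g h → ∃[ h′ ] ∀ x → (g α.• h β.• x) X.≈ (h′ β.• g α.• x)
    where
    module α = SimplyTransitiveAction α
    module β = SimplyTransitiveAction β

-- Inside Sym(X), simplicity of G forces G ∩ H to be G or 1. In the first case
-- G = H. In the second G and H commute, and h ↦ (the g with g h x₀ = x₀) is a
-- homomorphism because g h x₀ = x₀ is a condition on commuting factors.
module _ {ℓ : Level} {G H : Group ℓ ℓ} {X : Setoid ℓ ℓ}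
  (G-simple : IsSimple G) (x₀ : Setoid.Carrier X)
  (α : SimplyTransitiveAction G X) (β : SimplyTransitiveAction H X)
  (α-normalizes-β : Normalizes α β) (β-normalizes-α : Normalizes β α) where
  private
    module G = Group G
    module H = Group H
    module X = Setoid X
    module α = SimplyTransitiveAction α
    module β = SimplyTransitiveAction β
    open α using () renaming (_•_ to infixr 7 _·_)
    open β using () renaming (_•_ to infixr 7 _∗_)
    open Relation.Binary.Reasoning.Setoid X

    intersection : Subgroup G
    intersection = record
      { member    = λ g → ∃[ h ] ∀ x → (g · x) X.≈ (h ∗ x)
      ; resp      = λ p (h , q) → h , λ x → X.trans (α.•-cong (G.sym p) X.refl) (q x)
      ; ε-closed  = H.ε , λ x → X.trans (α.•-identity x) (X.sym (β.•-identity x))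
      ; ∙-closed  = λ {g} {g′} (h , p) (h′ , q) → h H.∙ h′ , λ x → begin
          (g G.∙ g′) · x ≈⟨ α.•-assoc g g′ x ⟩
          g · g′ · x     ≈⟨ p (g′ · x) ⟩
          h ∗ g′ · x     ≈⟨ β.•-cong H.refl (q x) ⟩
          h ∗ h′ ∗ x     ≈⟨ β.•-assoc h h′ x ⟨
          (h H.∙ h′) ∗ x ∎
      ; ⁻¹-closed = λ {g} (h , p) → h H.⁻¹ , λ x → begin
          g G.⁻¹ · x                  ≈⟨ β.•-inverseˡ h _ ⟨
          h H.⁻¹ ∗ h ∗ g G.⁻¹ · x     ≈⟨ β.•-cong H.refl (p _) ⟨
          h H.⁻¹ ∗ g · g G.⁻¹ · x     ≈⟨ β.•-cong H.refl (α.•-inverseʳ g x) ⟩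
          h H.⁻¹ ∗ x                  ∎
      }

    intersection-normal : IsNormal intersection
    intersection-normal g {k} (h , p) with α-normalizes-β g h
    ... | h′ , q = h′ , λ x → begin
      ((g G.∙ k) G.∙ g G.⁻¹) · x  ≈⟨ α.•-assoc _ _ x ⟩
      (g G.∙ k) · g G.⁻¹ · x      ≈⟨ α.•-assoc _ _ _ ⟩
      g · k · g G.⁻¹ · x          ≈⟨ α.•-cong G.refl (p _) ⟩
      g · h ∗ g G.⁻¹ · x          ≈⟨ q _ ⟩
      h′ ∗ g · g G.⁻¹ · x         ≈⟨ β.•-cong H.refl (α.•-inverseʳ g x) ⟩
      h′ ∗ x                      ∎

    module Full (full : ∀ g → ∃[ h ] ∀ x → (g · x) X.≈ (h ∗ x)) where

      φ : H.Carrier → G.Carrier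
      φ h = proj₁ (α.transitive x₀ (h ∗ x₀))

      -- By `full`, `φ h` acts as some h′ in H. As h′ and h agree at x₀, freeness gives h′ = h.
      φ-acts : ∀ h x → (φ h · x) X.≈ (h ∗ x)
      φ-acts h x with full (φ h)
      ... | h′ , p = X.trans (p x) (β.•-cong h′≈h X.refl)
        where
        h′≈h : h′ H.≈ h
        h′≈h = β.free x₀ (X.trans (X.sym (p x₀)) (proj₂ (α.transitive x₀ (h ∗ x₀))))

      iso : H ≅ G
      iso = bijectiveHomo⇒≅ H G φ
        (λ {h} {k} p → α.free x₀ (begin
          φ h · x₀ ≈⟨ φ-acts h x₀ ⟩
          h ∗ x₀   ≈⟨ β.•-cong p X.refl ⟩
          k ∗ x₀   ≈⟨ φ-acts k x₀ ⟨
          φ k · x₀ ∎))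
        (λ h k → α.free x₀ (begin
          φ (h H.∙ k) · x₀    ≈⟨ φ-acts _ x₀ ⟩
          (h H.∙ k) ∗ x₀      ≈⟨ β.•-assoc h k x₀ ⟩
          h ∗ k ∗ x₀          ≈⟨ β.•-cong H.refl (φ-acts k x₀) ⟨
          h ∗ φ k · x₀        ≈⟨ φ-acts h _ ⟨
          φ h · φ k · x₀      ≈⟨ α.•-assoc _ _ x₀ ⟨
          (φ h G.∙ φ k) · x₀  ∎))
        (λ {h} {k} p → β.free x₀ (begin
          h ∗ x₀   ≈⟨ φ-acts h x₀ ⟨
          φ h · x₀ ≈⟨ α.•-cong p X.refl ⟩
          φ k · x₀ ≈⟨ φ-acts k x₀ ⟩
          k ∗ x₀   ∎))
        (λ g → let (h , p) = full g in
          h , α.free x₀ (X.trans (φ-acts h x₀) (X.sym (p x₀))))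

    module Trivial (trivial : ∀ g → (∃[ h ] ∀ x → (g · x) X.≈ (h ∗ x)) → g G.≈ G.ε) where
      open Algebra.Properties.Group G using (x∙y⁻¹≈ε⇒x≈y)

      -- As permutations h′ = g h g⁻¹ and g′ = h g h⁻¹, so the commutator of g and h is g g′⁻¹ on
      -- one side and h′ h⁻¹ on the other. It lies in the intersection and is therefore trivial,
      -- which means g = g′.
      commute : ∀ g h x → (g · h ∗ x) X.≈ (h ∗ g · x)
      commute g h x with α-normalizes-β g h | β-normalizes-α h g
      ... | h′ , p | g′ , q = begin
        g · h ∗ x  ≈⟨ α.•-cong g≈g′ X.refl ⟩
        g′ · h ∗ x ≈⟨ q x ⟨
        h ∗ g · x  ∎
        where
        commutator-acts : ∀ y → ((g G.∙ g′ G.⁻¹) · y) X.≈ ((h′ H.∙ h H.⁻¹) ∗ y)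
        commutator-acts y = begin
          (g G.∙ g′ G.⁻¹) · y                           ≈⟨ α.•-assoc _ _ y ⟩
          g · g′ G.⁻¹ · y                               ≈⟨ α.•-cong G.refl (β.•-inverseʳ h _) ⟨
          g · h ∗ h H.⁻¹ ∗ g′ G.⁻¹ · y                  ≈⟨ p _ ⟩
          h′ ∗ g · h H.⁻¹ ∗ g′ G.⁻¹ · y                 ≈⟨ β.•-cong H.refl (β.•-inverseˡ h _) ⟨
          h′ ∗ h H.⁻¹ ∗ h ∗ g · h H.⁻¹ ∗ g′ G.⁻¹ · y    ≈⟨ β.•-cong H.refl (β.•-cong H.refl (q _)) ⟩
          h′ ∗ h H.⁻¹ ∗ g′ · h ∗ h H.⁻¹ ∗ g′ G.⁻¹ · y   ≈⟨ β.•-cong H.refl (β.•-cong H.refl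
                                                             (α.•-cong G.refl (β.•-inverseʳ h _))) ⟩
          h′ ∗ h H.⁻¹ ∗ g′ · g′ G.⁻¹ · y                ≈⟨ β.•-cong H.refl (β.•-cong H.refl
                                                             (α.•-inverseʳ g′ y)) ⟩
          h′ ∗ h H.⁻¹ ∗ y                               ≈⟨ β.•-assoc _ _ y ⟨
          (h′ H.∙ h H.⁻¹) ∗ y                           ∎

        g≈g′ : g G.≈ g′
        g≈g′ = x∙y⁻¹≈ε⇒x≈y g g′ (trivial _ (_ , commutator-acts))

      -- For commuting actions the condition g x₀ = h x₀ would define an anti-homomorphism; asking
      -- for g h x₀ = x₀ adds the inversion that repairs the order.
      φ : H.Carrier → G.Carrier
      φ h = proj₁ (α.transitive (h ∗ x₀) x₀)

      φ-fixes : ∀ h → (φ h · h ∗ x₀) X.≈ x₀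
      φ-fixes h = proj₂ (α.transitive (h ∗ x₀) x₀)

      φ-unique : ∀ {g h} → (g · h ∗ x₀) X.≈ x₀ → φ h G.≈ g
      φ-unique p = α.free _ (X.trans (φ-fixes _) (X.sym p))

      iso : H ≅ G
      iso = bijectiveHomo⇒≅ H G φ
        (λ {h} {k} p → φ-unique
          (X.trans (α.•-cong G.refl (β.•-cong p X.refl)) (φ-fixes k)))
        (λ h k → φ-unique (begin
          (φ h G.∙ φ k) · (h H.∙ k) ∗ x₀ ≈⟨ α.•-assoc _ _ _ ⟩
          φ h · φ k · (h H.∙ k) ∗ x₀     ≈⟨ α.•-cong G.refl (α.•-cong G.refl (β.•-assoc h k x₀)) ⟩
          φ h · φ k · h ∗ k ∗ x₀         ≈⟨ α.•-cong G.refl (commute _ h _) ⟩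
          φ h · h ∗ φ k · k ∗ x₀         ≈⟨ α.•-cong G.refl (β.•-cong H.refl (φ-fixes k)) ⟩
          φ h · h ∗ x₀                   ≈⟨ φ-fixes h ⟩
          x₀                             ∎))
        (λ {h} {k} p → β.free x₀ (begin
          h ∗ x₀                     ≈⟨ α.•-inverseˡ (φ h) _ ⟨
          φ h G.⁻¹ · φ h · h ∗ x₀    ≈⟨ α.•-cong G.refl (X.trans (φ-fixes h) (X.sym (φ-fixes k))) ⟩
          φ h G.⁻¹ · φ k · k ∗ x₀    ≈⟨ α.•-cong G.refl (α.•-cong p X.refl) ⟨
          φ h G.⁻¹ · φ h · k ∗ x₀    ≈⟨ α.•-inverseˡ (φ h) _ ⟩
          k ∗ x₀                     ∎))
        (λ g → let (h , p) = β.transitive (g · x₀) x₀ in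
          h , φ-unique (X.trans (commute g h x₀) p))

  simplyTransitive⇒≅ : H ≅ G
  simplyTransitive⇒≅ with proj₂ G-simple intersection intersection-normal
  ... | inj₁ trivial = Trivial.iso trivial
  ... | inj₂ full    = Full.iso full

-- Normal complements acting on cosets

module _ {ℓ : Level} (Γ : Group ℓ ℓ) (U : Subgroup Γ) where
  open Group Γ
  open Algebra.Properties.Group Γ
  private module U = Subgroup U

  leftCosets : Setoid ℓ ℓ
  leftCosets = record
    { Carrier       = Carrier
    ; _≈_           = λ x y → (x ⁻¹ ∙ y) ∈ U.member
    ; isEquivalence = record
      { refl  = λ {x} → U.resp (sym (inverseˡ x)) U.ε-closed
      ; sym   = λ {x} {y} p → U.resp
          (trans (⁻¹-anti-homo-∙ _ _) (∙-congˡ (⁻¹-involutive x))) (U.⁻¹-closed p)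
      ; trans = λ {x} {y} {z} p q → U.resp
          (trans (assoc _ _ _) (∙-congˡ (\\-leftDividesˡ y z)))
          (U.∙-closed p q)
      }
    }

  module _ (N : Subgroup Γ) (N-complement : IsNormalComplement U N) where
    private
      module N = Subgroup N
      module X = Setoid leftCosets
      open Relation.Binary.Reasoning.Setoid setoid

      factor = proj₁ (proj₁ N-complement)
      factor-unique = proj₂ (proj₁ N-complement)

      ≈⇒X≈ : ∀ {x y} → x ≈ y → x X.≈ y
      ≈⇒X≈ {x} p = U.resp (trans (sym (inverseˡ x)) (∙-congˡ p)) U.ε-closed

      N∩U : ∀ {n} → n ∈ N.member → n ∈ U.member → n ≈ ε
      N∩U {n} n∈N n∈U = proj₁ (factor-unique n∈N N.ε-closed U.ε-closed n∈U
        (trans (identityʳ n) (sym (identityˡ n))))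

      conj∈N : ∀ {n} x → n ∈ N.member → (x ⁻¹ ∙ n) ∙ x ∈ N.member
      conj∈N x p = N.resp (∙-congˡ (⁻¹-involutive x)) (proj₂ N-complement (x ⁻¹) p)

    -- Existence of the factorization gives transitivity and uniqueness gives freeness, once
    -- normality moves N past x. From x⁻¹y = n u follows y = (x n x⁻¹) x u; and if n x U = m x U,
    -- then x⁻¹(n⁻¹m)x lies in both N and U, so it is ε.
    complementAction : SimplyTransitiveAction N.group leftCosets
    complementAction = record
      { _•_        = λ n x → proj₁ n ∙ x
      ; •-cong     = λ {n} {m} {x} {y} p q → U.resp (begin
          x ⁻¹ ∙ y                                ≈⟨ ∙-congˡ (\\-leftDividesʳ (proj₁ n) y) ⟨
          x ⁻¹ ∙ (proj₁ n ⁻¹ ∙ (proj₁ n ∙ y))      ≈⟨ assoc _ _ _ ⟨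
          (x ⁻¹ ∙ proj₁ n ⁻¹) ∙ (proj₁ n ∙ y)      ≈⟨ ∙-congʳ (⁻¹-anti-homo-∙ _ _) ⟨
          (proj₁ n ∙ x) ⁻¹ ∙ (proj₁ n ∙ y)        ≈⟨ ∙-congˡ (∙-congʳ p) ⟩
          (proj₁ n ∙ x) ⁻¹ ∙ (proj₁ m ∙ y)        ∎) q
      ; •-assoc    = λ n m x → ≈⇒X≈ (assoc _ _ _)
      ; transitive = λ x y →
          let (n , u , n∈N , u∈U , x⁻¹y≈nu) = factor (x ⁻¹ ∙ y)
              m   = (x ∙ n) ∙ x ⁻¹
          in (m , proj₂ N-complement x n∈N) , U.resp (begin
            u                             ≈⟨ \\-leftDividesʳ n u ⟨
            n ⁻¹ ∙ (n ∙ u)                ≈⟨ ∙-congˡ x⁻¹y≈nu ⟨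
            n ⁻¹ ∙ (x ⁻¹ ∙ y)             ≈⟨ assoc _ _ _ ⟨
            (n ⁻¹ ∙ x ⁻¹) ∙ y             ≈⟨ ∙-congʳ (⁻¹-anti-homo-∙ _ _) ⟨
            (x ∙ n) ⁻¹ ∙ y                ≈⟨ ∙-congʳ (⁻¹-cong (//-rightDividesˡ x (x ∙ n))) ⟨
            (m ∙ x) ⁻¹ ∙ y                ∎) u∈U
      ; free       = λ {n} {m} x p →
          let k = proj₁ n ⁻¹ ∙ proj₁ m
              q : (x ⁻¹ ∙ k) ∙ x ≈ ε
              q = N∩U (conj∈N x (N.∙-closed (N.⁻¹-closed (proj₂ n)) (proj₂ m)))
                (U.resp (begin
                  (proj₁ n ∙ x) ⁻¹ ∙ (proj₁ m ∙ x)      ≈⟨ ∙-congʳ (⁻¹-anti-homo-∙ _ _) ⟩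
                  (x ⁻¹ ∙ proj₁ n ⁻¹) ∙ (proj₁ m ∙ x)   ≈⟨ assoc _ _ _ ⟨
                  ((x ⁻¹ ∙ proj₁ n ⁻¹) ∙ proj₁ m) ∙ x   ≈⟨ ∙-congʳ (assoc _ _ _) ⟩
                  (x ⁻¹ ∙ k) ∙ x                        ∎) p)
              r : k ≈ ε
              r = begin
                k                       ≈⟨ \\-leftDividesˡ x k ⟨
                x ∙ (x ⁻¹ ∙ k)          ≈⟨ ∙-congˡ (inverseˡ-unique _ _ q) ⟩
                x ∙ x ⁻¹                ≈⟨ inverseʳ x ⟩
                ε                       ∎
          in sym (begin
            proj₁ m                     ≈⟨ \\-leftDividesˡ (proj₁ n) (proj₁ m) ⟨
            proj₁ n ∙ k                 ≈⟨ ∙-congˡ r ⟩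
            proj₁ n ∙ ε                 ≈⟨ identityʳ _ ⟩
            proj₁ n                     ∎)
      }

  normalComplements-normalize :
    ∀ N N′ (c : IsNormalComplement U N) (c′ : IsNormalComplement U N′) →
    Normalizes (complementAction N c) (complementAction N′ c′)
  normalComplements-normalize N N′ c c′ (n , _) (n′ , n′∈N′) =
    ((n ∙ n′) ∙ n ⁻¹ , proj₂ c′ n n′∈N′) , λ x → U.resp
      (sym (trans (∙-congˡ (begin
        ((n ∙ n′) ∙ n ⁻¹) ∙ (n ∙ x)  ≈⟨ assoc _ _ _ ⟩
        (n ∙ n′) ∙ (n ⁻¹ ∙ (n ∙ x))  ≈⟨ ∙-congˡ (\\-leftDividesʳ n x) ⟩
        (n ∙ n′) ∙ x                 ≈⟨ assoc _ _ _ ⟩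
        n ∙ (n′ ∙ x)                 ∎)) (inverseˡ _)))
      U.ε-closed
    where open Relation.Binary.Reasoning.Setoid setoid

normalComplements-≅ : ∀ {ℓ} {G Γ : Group ℓ ℓ} → IsSimple G →
  (U N : Subgroup Γ) → IsNormalComplement U N → Subgroup.group N ≅ G →
  (N′ : Subgroup Γ) → IsNormalComplement U N′ → Subgroup.group N′ ≅ G
normalComplements-≅ {G = G} {Γ} G-simple U N c N≅G N′ c′ =
  ≅-trans N′.group N.group G
    (simplyTransitive⇒≅
      (IsSimple-resp-≅ G N.group (≅-sym N.group G N≅G) G-simple) (Group.ε Γ)
      (complementAction Γ U N c) (complementAction Γ U N′ c′)
      (normalComplements-normalize Γ U N N′ c c′) (normalComplements-normalize Γ U N′ N c′ c))
    N≅G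
  where
  module N = Subgroup N
  module N′ = Subgroup N′

-- Spanning families and quotient fields

module _ {ℓ : Level} (R S : CommutativeRing ℓ ℓ) where
  private
    module R = CommutativeRing R
    module S = CommutativeRing S
  open Algebra.Properties.AbelianGroup S.+-abelianGroup
    using (identityˡ-unique; inverseˡ-unique)

  ringHomomorphism :
    (f : R.Carrier → S.Carrier) →
    (∀ {x y} → x R.≈ y → f x S.≈ f y) →
    (∀ x y → f (x R.+ y) S.≈ f x S.+ f y) →
    (∀ x y → f (x R.* y) S.≈ f x S.* f y) →
    f R.1# S.≈ S.1# →
    IsRingHomomorphism R.rawRing S.rawRing f
  ringHomomorphism f cong +-homo *-homo 1-homo = record
    { isSemiringHomomorphism = record
      { isNearSemiringHomomorphism = record
        { +-isMonoidHomomorphism = record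
          { isMagmaHomomorphism = record
            { isRelHomomorphism = record { cong = cong }
            ; homo              = +-homo
            }
          ; ε-homo = 0-homo
          }
        ; *-homo = *-homo
        }
      ; 1#-homo = 1-homo
      }
    ; -‿homo = λ x → inverseˡ-unique _ _
        (S.trans (S.sym (+-homo _ x)) (S.trans (cong (R.-‿inverseˡ x)) 0-homo))
    }
    where
    0-homo : f R.0# S.≈ S.0#
    0-homo = identityˡ-unique _ _ (S.trans (S.sym (+-homo _ _)) (cong (R.+-identityˡ R.0#)))

module Field {ℓ : Level} (R : CommutativeRing ℓ ℓ) (R-isField : IsField R) where
  open CommutativeRing R
  open Relation.Binary.Reasoning.Setoid setoid

  inverse : ∀ {x} → ¬ (x ≈ 0#) → ∃[ y ] y * x ≈ 1#
  inverse x≉0 = let (y , yx≈1 , _) = proj₂ R-isField _ x≉0 in y , yx≈1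

  *-cancelˡ-0 : ∀ {x y} → ¬ (x ≈ 0#) → x * y ≈ 0# → y ≈ 0#
  *-cancelˡ-0 {x} {y} x≉0 xy≈0 = let (u , ux≈1) = inverse x≉0 in begin
    y           ≈⟨ *-identityˡ y ⟨
    1# * y      ≈⟨ *-congʳ ux≈1 ⟨
    (u * x) * y ≈⟨ *-assoc u x y ⟩
    u * (x * y) ≈⟨ *-congˡ xy≈0 ⟩
    u * 0#      ≈⟨ zeroʳ u ⟩
    0#          ∎

module _ {ℓ : Level} {k : CommutativeRing ℓ ℓ} where

  record AlgebraHom (A B : Algebra k) : Set ℓ where
    private
      module A = Algebra A
      module B = Algebra B
    field
      ⟦_⟧                : A.Carrier → B.Carrier
      isRingHomomorphism : IsRingHomomorphism A.rawRing B.rawRing ⟦_⟧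
      preserves-ι        : ∀ c → ⟦ A.ι c ⟧ B.≈ B.ι c

    open IsRingHomomorphism isRingHomomorphism public
      using (⟦⟧-cong; +-homo; *-homo; 0#-homo; 1#-homo; -‿homo)

  idₐ : {A : Algebra k} → AlgebraHom A A
  idₐ {A} = record
    { ⟦_⟧                = id
    ; isRingHomomorphism = Identity.isRingHomomorphism (Algebra.rawRing A) (Algebra.refl A)
    ; preserves-ι        = λ c → Algebra.refl A
    }

  infixr 9 _∘ₐ_
  _∘ₐ_ : {A B C : Algebra k} → AlgebraHom B C → AlgebraHom A B → AlgebraHom A C
  _∘ₐ_ {C = C} g f = record
    { ⟦_⟧                = g.⟦_⟧ ∘ f.⟦_⟧
    ; isRingHomomorphism = Compose.isRingHomomorphism (Algebra.trans C)
        f.isRingHomomorphism g.isRingHomomorphism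
    ; preserves-ι        = λ c →
        Algebra.trans C (g.⟦⟧-cong (f.preserves-ι c)) (g.preserves-ι c)
    }
    where
    module f = AlgebraHom f
    module g = AlgebraHom g

  -- The same ring can thus be used over different bases, so that linear algebra and Galois theory
  -- apply over A instead of k.
  along : {A B : Algebra k} → AlgebraHom A B → Algebra (Algebra.commutativeRing A)
  along {B = B} f = record
    { commutativeRing    = Algebra.commutativeRing B
    ; ι                  = AlgebraHom.⟦_⟧ f
    ; isRingHomomorphism = AlgebraHom.isRingHomomorphism f
    }

  restrictScalars : (A : Algebra k) → Algebra (Algebra.commutativeRing A) → Algebra k
  restrictScalars A B = record
    { commutativeRing    = B.commutativeRing
    ; ι                  = B.ι ∘ A.ι
    ; isRingHomomorphism = Compose.isRingHomomorphism B.trans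
        A.isRingHomomorphism B.isRingHomomorphism
    }
    where
    module A = Algebra A
    module B = Algebra B

  module _ {A B : Algebra k} (f : AlgebraHom A B) where
    private
      module A = Algebra A
      module B = Algebra B
    open AlgebraHom f
    open Relation.Binary.Reasoning.Setoid B.setoid

    fieldHom-injective : IsField A.commutativeRing → ¬ (B.0# B.≈ B.1#) → ExcludedMiddle ℓ →
      ∀ {x y} → ⟦ x ⟧ B.≈ ⟦ y ⟧ → x A.≈ y
    fieldHom-injective A-isField 0≉1 em {x} {y} fx≈fy = x∙y⁻¹≈ε⇒x≈y x y
      (decidable-stable em λ x-y≉0 →
        let (u , u[x-y]≈1) = Field.inverse A.commutativeRing A-isField x-y≉0
        in 0≉1 (begin
          B.0#                        ≈⟨ B.zeroʳ ⟦ u ⟧ ⟨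
          ⟦ u ⟧ B.* B.0#              ≈⟨ B.*-congˡ (B.-‿inverseʳ ⟦ y ⟧) ⟨
          ⟦ u ⟧ B.* (⟦ y ⟧ B.- ⟦ y ⟧) ≈⟨ B.*-congˡ (B.+-congʳ fx≈fy) ⟨
          ⟦ u ⟧ B.* (⟦ x ⟧ B.- ⟦ y ⟧) ≈⟨ B.*-congˡ (B.+-congˡ (-‿homo y)) ⟨
          ⟦ u ⟧ B.* (⟦ x ⟧ B.+ ⟦ A.- y ⟧) ≈⟨ B.*-congˡ (+-homo x (A.- y)) ⟨
          ⟦ u ⟧ B.* ⟦ x A.- y ⟧       ≈⟨ *-homo u (x A.- y) ⟨
          ⟦ u A.* (x A.- y) ⟧         ≈⟨ ⟦⟧-cong u[x-y]≈1 ⟩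
          ⟦ A.1# ⟧                    ≈⟨ 1#-homo ⟩
          B.1#                        ∎))
      where open Algebra.Properties.AbelianGroup A.+-abelianGroup using (x∙y⁻¹≈ε⇒x≈y)

module _ {ℓ : Level} (M N : CommutativeMonoid ℓ ℓ) where
  private
    module M = CommutativeMonoid M
    module N = CommutativeMonoid N
  open Algebra.Definitions.RawMonoid M.rawMonoid using () renaming (sum to sumₘ)
  open Algebra.Definitions.RawMonoid N.rawMonoid using () renaming (sum to sumₙ)

  sum-homo : (f : M.Carrier → N.Carrier) → f M.ε N.≈ N.ε →
    (∀ x y → f (x M.∙ y) N.≈ f x N.∙ f y) →
    ∀ {n} (t : Vector M.Carrier n) → f (sumₘ t) N.≈ sumₙ (f ∘ t)
  sum-homo f ε-homo ∙-homo {zero}  t = ε-homo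
  sum-homo f ε-homo ∙-homo {suc n} t =
    N.trans (∙-homo _ _) (N.∙-congˡ (sum-homo f ε-homo ∙-homo (t ∘ suc)))

module Span {ℓ : Level} {k : CommutativeRing ℓ ℓ} (A : Algebra k) where
  private module k = CommutativeRing k
  open Algebra A
  open IsRingHomomorphism isRingHomomorphism
  open Algebra.Properties.Semiring.Sum semiring
  open Algebra.Properties.Ring ring
  open Relation.Binary.Reasoning.Setoid setoid

  combination : ∀ {n} → Vector Carrier n → Vector k.Carrier n → Carrier
  combination e c = sum (λ i → ι (c i) * e i)

  Spans : ∀ {n} → Vector Carrier n → Set ℓ
  Spans e = ∀ x → ∃[ c ] x ≈ combination e c

  combination-cong : ∀ {n} (e : Vector Carrier n) {c d} →
    (∀ i → c i k.≈ d i) → combination e c ≈ combination e d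
  combination-cong e p = sum-cong-≋ (λ i → *-congʳ (⟦⟧-cong (p i)))

  combination-0 : ∀ {n} (e : Vector Carrier n) {c} →
    (∀ i → c i k.≈ k.0#) → combination e c ≈ 0#
  combination-0 {n} e {c} p = begin
    combination e c    ≈⟨ sum-cong-≋ {n} (λ i →
                            trans (*-congʳ (trans (⟦⟧-cong (p i)) 0#-homo)) (zeroˡ (e i))) ⟩
    sum {n} (λ i → 0#) ≈⟨ sum-replicate-zero n ⟩
    0#                 ∎

  -- The form d + a c is the one elimination uses; sums, differences and negatives are its cases a =
  -- 1 and a = -1.
  combination-linear : ∀ {n} (e : Vector Carrier n) a c d →
    combination e (λ i → d i k.+ a k.* c i) ≈ combination e d + ι a * combination e c
  combination-linear {n} e a c d = begin
    combination e (λ i → d i k.+ a k.* c i)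
      ≈⟨ sum-cong-≋ (λ i → begin
        ι (d i k.+ a k.* c i) * e i           ≈⟨ *-congʳ (+-homo _ _) ⟩
        (ι (d i) + ι (a k.* c i)) * e i       ≈⟨ distribʳ _ _ _ ⟩
        ι (d i) * e i + ι (a k.* c i) * e i   ≈⟨ +-congˡ (*-congʳ (*-homo _ _)) ⟩
        ι (d i) * e i + (ι a * ι (c i)) * e i ≈⟨ +-congˡ (*-assoc _ _ _) ⟩
        ι (d i) * e i + ι a * (ι (c i) * e i) ∎) ⟩
    sum (λ i → ι (d i) * e i + ι a * (ι (c i) * e i))
      ≈⟨ ∑-distrib-+ {n} _ _ ⟩
    combination e d + sum (λ i → ι a * (ι (c i) * e i))
      ≈⟨ +-congˡ (*-distribˡ-sum {n} _ _) ⟨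
    combination e d + ι a * combination e c ∎

  combination-difference : ∀ {n} (e : Vector Carrier n) c d →
    combination e c ≈ combination e d → combination e (λ i → c i k.- d i) ≈ 0#
  combination-difference e c d p = begin
    combination e (λ i → c i k.- d i)
      ≈⟨ combination-cong e (λ i → k.+-congˡ (Algebra.Properties.Ring.-1*x≈-x k.ring (d i))) ⟨
    combination e (λ i → c i k.+ (k.- k.1#) k.* d i)
      ≈⟨ combination-linear e (k.- k.1#) d c ⟩
    combination e c + ι (k.- k.1#) * combination e d
      ≈⟨ +-cong p (*-congʳ (trans (-‿homo k.1#) (-‿cong 1#-homo))) ⟩
    combination e d + (- 1#) * combination e d
      ≈⟨ +-congˡ (-1*x≈-x _) ⟩
    combination e d - combination e d
      ≈⟨ -‿inverseʳ _ ⟩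
    0# ∎

  -- Adding -dᵢ/cᵢ times the relation c to the coordinates d of x leaves the sum unchanged and makes
  -- the i-th coordinate vanish.
  dropGenerator : IsField k → ∀ {n} (e : Vector Carrier (suc n)) → Spans e →
    ∀ c i → combination e c ≈ 0# → ¬ (c i k.≈ k.0#) → Spans (removeAt e i)
  dropGenerator k-isField e spans c i ec≈0 cᵢ≉0 x
    with spans x | Field.inverse k k-isField cᵢ≉0
  ... | d , x≈ed | u , ucᵢ≈1 = removeAt d′ i , (begin
    x                                             ≈⟨ x≈ed ⟩
    combination e d                               ≈⟨ +-identityʳ _ ⟨
    combination e d + 0#                          ≈⟨ +-congˡ (zeroʳ (ι a)) ⟨
    combination e d + ι a * 0#                    ≈⟨ +-congˡ (*-congˡ ec≈0) ⟨
    combination e d + ι a * combination e c       ≈⟨ combination-linear e a c d ⟨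
    combination e d′                              ≈⟨ sum-remove {i = i} (λ j → ι (d′ j) * e j) ⟩
    ι (d′ i) * e i + combination (removeAt e i) (removeAt d′ i)
      ≈⟨ +-congʳ (trans (*-congʳ (trans (⟦⟧-cong d′ᵢ≈0) 0#-homo)) (zeroˡ _)) ⟩
    0# + combination (removeAt e i) (removeAt d′ i)
      ≈⟨ +-identityˡ _ ⟩
    combination (removeAt e i) (removeAt d′ i)    ∎)
    where
    a = k.- (d i k.* u)
    d′ = λ j → d j k.+ a k.* c j

    d′ᵢ≈0 : d′ i k.≈ k.0#
    d′ᵢ≈0 = k.trans (k.+-congˡ (k.trans
      (k.sym (Algebra.Properties.Ring.-‿distribˡ-* k.ring _ _))
      (k.-‿cong (k.trans (k.*-assoc _ _ _) (k.trans (k.*-congˡ ucᵢ≈1) (k.*-identityʳ _))))))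
      (k.-‿inverseʳ _)

module _ {ℓ : Level} {k : CommutativeRing ℓ ℓ} where
  private module k = CommutativeRing k

  IsFinitelySpanned : Algebra k → Set ℓ
  IsFinitelySpanned A = ∃[ n ] Σ[ e ∈ Vector (Algebra.Carrier A) n ] Span.Spans A e

  -- Excluded middle decides whether some relation is left. Each relation removes a generator;
  -- without one, two coordinate vectors of the same element differ by zero.
  spanned⇒finiteDimensional : ExcludedMiddle ℓ → IsField k →
    (A : Algebra k) → IsFinitelySpanned A → IsFiniteDimensional A
  spanned⇒finiteDimensional em k-isField A (n , e , spans) = reduce n e spans
    where
    open Algebra A
    open Span A
    open Algebra.Properties.AbelianGroup k.+-abelianGroup using (x∙y⁻¹≈ε⇒x≈y)

    Dependent : ∀ {n} → Vector Carrier n → Set ℓ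
    Dependent e = ∃[ c ] ∃[ i ] combination e c ≈ 0# × ¬ (c i k.≈ k.0#)

    reduce : ∀ n (e : Vector Carrier n) → Spans e → IsFiniteDimensional A
    reduce n e spans with em {Dependent e}
    reduce (suc n) e spans | yes (c , i , ec≈0 , cᵢ≉0) =
      reduce n (removeAt e i) (dropGenerator k-isField e spans c i ec≈0 cᵢ≉0)
    reduce n e spans | no independent = n , e , spans , λ c d ec≈ed i →
      x∙y⁻¹≈ε⇒x≈y _ _ (decidable-stable em λ cᵢ-dᵢ≉0 →
        independent (_ , i , combination-difference e c d ec≈ed , cᵢ-dᵢ≉0))

  module _ (A : Algebra k) (x : Algebra.Carrier A) where
    open Algebra A
    open Algebra.Properties.Ring ring using (-‿distribʳ-*; -‿+-comm)
    open Algebra.Properties.CommutativeSemigroup +-commutativeSemigroup using (interchange)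
    open Relation.Binary.Reasoning.Setoid setoid

    -- Only the equality changes: it becomes a - b ∈ xA on the old carrier, so the operations and
    -- the ring laws are inherited, and the quotient map is the identity function.
    quotientByPrincipal : Algebra k
    quotientByPrincipal = record
      { commutativeRing = record
        { Carrier = Carrier
        ; _≈_     = _≋_
        ; _+_     = _+_
        ; _*_     = _*_
        ; -_      = -_
        ; 0#      = 0#
        ; 1#      = 1#
        ; isCommutativeRing = record
          { isRing = record
            { +-isAbelianGroup = record
              { isGroup = record
                { isMonoid = record
                  { isSemigroup = record
                    { isMagma = record
                      { isEquivalence = record
                        { refl  = ≈⇒≋ refl
                        ; sym   = ≋-sym
                        ; trans = ≋-trans
                        }
                      ; ∙-cong = ≋-+-cong
                      }
                    ; assoc = λ a b c → ≈⇒≋ (+-assoc a b c)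
                    }
                  ; identity = (λ a → ≈⇒≋ (+-identityˡ a)) , (λ a → ≈⇒≋ (+-identityʳ a))
                  }
                ; inverse = (λ a → ≈⇒≋ (-‿inverseˡ a)) , (λ a → ≈⇒≋ (-‿inverseʳ a))
                ; ⁻¹-cong = ≋-neg-cong
                }
              ; comm = λ a b → ≈⇒≋ (+-comm a b)
              }
            ; *-cong     = λ {a} {b} {c} {d} p q → ≋-trans (≋-*-congʳ c p)
                (≋-trans (≈⇒≋ (*-comm b c)) (≋-trans (≋-*-congʳ b q) (≈⇒≋ (*-comm d b))))
            ; *-assoc    = λ a b c → ≈⇒≋ (*-assoc a b c)
            ; *-identity = (λ a → ≈⇒≋ (*-identityˡ a)) , (λ a → ≈⇒≋ (*-identityʳ a))
            ; distrib    = (λ a b c → ≈⇒≋ (distribˡ a b c)) , (λ a b c → ≈⇒≋ (distribʳ a b c))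
            }
          ; *-comm = λ a b → ≈⇒≋ (*-comm a b)
          }
        }
      ; ι = ι
      ; isRingHomomorphism = record
        { isSemiringHomomorphism = record
          { isNearSemiringHomomorphism = record
            { +-isMonoidHomomorphism = record
              { isMagmaHomomorphism = record
                { isRelHomomorphism = record { cong = λ p → ≈⇒≋ (ι-hom.⟦⟧-cong p) }
                ; homo              = λ a b → ≈⇒≋ (ι-hom.+-homo a b)
                }
              ; ε-homo = ≈⇒≋ ι-hom.0#-homo
              }
            ; *-homo = λ a b → ≈⇒≋ (ι-hom.*-homo a b)
            }
          ; 1#-homo = ≈⇒≋ ι-hom.1#-homo
          }
        ; -‿homo = λ a → ≈⇒≋ (ι-hom.-‿homo a)
        }
      }
      where
      module ι-hom = IsRingHomomorphism isRingHomomorphism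

      infix 4 _≋_
      _≋_ : Carrier → Carrier → Set ℓ
      a ≋ b = ∃[ y ] a ≈ b + x * y

      ≈⇒≋ : ∀ {a b} → a ≈ b → a ≋ b
      ≈⇒≋ {a} {b} p = 0# , trans p (sym (trans (+-congˡ (zeroʳ x)) (+-identityʳ b)))

      ≋-sym : ∀ {a b} → a ≋ b → b ≋ a
      ≋-sym {a} {b} (y , p) = - y , (begin
        b                       ≈⟨ +-identityʳ b ⟨
        b + 0#                  ≈⟨ +-congˡ (-‿inverseʳ (x * y)) ⟨
        b + (x * y - x * y)     ≈⟨ +-assoc _ _ _ ⟨
        b + x * y - x * y       ≈⟨ +-cong (sym p) (-‿distribʳ-* x y) ⟩
        a + x * - y             ∎)

      ≋-trans : ∀ {a b c} → a ≋ b → b ≋ c → a ≋ c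
      ≋-trans {a} {b} {c} (y , p) (z , q) = z + y , (begin
        a                       ≈⟨ p ⟩
        b + x * y               ≈⟨ +-congʳ q ⟩
        c + x * z + x * y       ≈⟨ +-assoc _ _ _ ⟩
        c + (x * z + x * y)     ≈⟨ +-congˡ (distribˡ x z y) ⟨
        c + x * (z + y)         ∎)

      ≋-+-cong : ∀ {a b c d} → a ≋ b → c ≋ d → a + c ≋ b + d
      ≋-+-cong {a} {b} {c} {d} (y , p) (z , q) = y + z , (begin
        a + c                       ≈⟨ +-cong p q ⟩
        (b + x * y) + (d + x * z)   ≈⟨ interchange _ _ _ _ ⟩
        (b + d) + (x * y + x * z)   ≈⟨ +-congˡ (distribˡ x y z) ⟨
        (b + d) + x * (y + z)       ∎)

      ≋-neg-cong : ∀ {a b} → a ≋ b → - a ≋ - b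
      ≋-neg-cong {a} {b} (y , p) = - y , (begin
        - a                         ≈⟨ -‿cong p ⟩
        - (b + x * y)               ≈⟨ -‿+-comm b (x * y) ⟨
        - b - x * y                 ≈⟨ +-congˡ (-‿distribʳ-* x y) ⟩
        - b + x * - y               ∎)

      ≋-*-congʳ : ∀ {a b} c → a ≋ b → a * c ≋ b * c
      ≋-*-congʳ {a} {b} c (y , p) = y * c , (begin
        a * c                       ≈⟨ *-congʳ p ⟩
        (b + x * y) * c             ≈⟨ distribʳ _ _ _ ⟩
        b * c + (x * y) * c         ≈⟨ +-congˡ (*-assoc x y c) ⟩
        b * c + x * (y * c)         ∎)

    quotientMap : AlgebraHom A quotientByPrincipal
    quotientMap = record
      { ⟦_⟧ = λ a → a
      ; isRingHomomorphism = ringHomomorphism commutativeRing Q.commutativeRing (λ a → a)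
          ≈⇒Q≈ (λ a b → Q.refl) (λ a b → Q.refl) Q.refl
      ; preserves-ι = λ c → Q.refl
      }
      where
      module Q = Algebra quotientByPrincipal
      ≈⇒Q≈ : ∀ {a b} → a ≈ b → a Q.≈ b
      ≈⇒Q≈ {a} {b} p = 0# , trans p (sym (trans (+-congˡ (zeroʳ x)) (+-identityʳ b)))

  -- Dividing by a nonzero nonunit lowers the number of generators.
  fieldQuotient : ExcludedMiddle ℓ → IsField k →
    ∀ n (A : Algebra k) (e : Vector (Algebra.Carrier A) n) → Span.Spans A e →
    ¬ (Algebra._≈_ A (Algebra.0# A) (Algebra.1# A)) →
    Σ[ Q ∈ Algebra k ] IsField (Algebra.commutativeRing Q) × IsFinitelySpanned Q × AlgebraHom A Q
  fieldQuotient em k-isField n A e spans 0≉1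
    with em {∃[ x ] ¬ (Algebra._≈_ A x (Algebra.0# A)) ×
                    ¬ (∃[ y ] Algebra._≈_ A (Algebra._*_ A x y) (Algebra.1# A))}
  ... | no allInvertible = A , (0≉1 , invertible) , (n , e , spans) , idₐ
    where
    open Algebra A

    invertible : ∀ x → ¬ (x ≈ 0#) → ∃[ y ] y * x ≈ 1# × x * y ≈ 1#
    invertible x x≉0 with em {∃[ y ] x * y ≈ 1#}
    ... | yes (y , p)  = y , trans (*-comm y x) p , p
    ... | no  noninvertible = ⊥-elim (allInvertible (x , x≉0 , noninvertible))
  ... | yes (x , x≉0 , noninvertible) with spans x
  ... | c , x≈ec with em {∃[ i ] ¬ (c i k.≈ k.0#)}
  ...   | no allZero = ⊥-elim (x≉0 (trans x≈ec
            (Span.combination-0 A e λ i → decidable-stable em λ cᵢ≉0 → allZero (i , cᵢ≉0))))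
    where open Algebra A
  fieldQuotient em k-isField (suc n) A e spans 0≉1
      | yes (x , x≉0 , noninvertible) | c , x≈ec | yes (i , cᵢ≉0) =
    let (Q , Q-isField , Q-spanned , h) =
          fieldQuotient em k-isField n A/x (removeAt e i)
            -- In A/x the expansion x = Σ cᵢeᵢ turns into a relation, and it is nontrivial because x
            -- ≠ 0.
            (Span.dropGenerator A/x k-isField e
              (λ y → let (d , y≈ed) = spans y in d , π.⟦⟧-cong y≈ed)
              c i (A/x.trans (A/x.sym (π.⟦⟧-cong x≈ec)) x≋0) cᵢ≉0)
            -- The quotient is not the zero ring: 0 = 1 there reads 0 = 1 + xy in A, and -y would
            -- invert x.
            (λ (y , p) → noninvertible (- y , 1≈x-y y p))
    in Q , Q-isField , Q-spanned , h ∘ₐ quotientMap A x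
    where
    open Algebra A
    open Algebra.Properties.Ring ring using (-‿distribʳ-*; -‿+-comm)
    A/x = quotientByPrincipal A x
    module A/x = Algebra A/x
    module π = AlgebraHom (quotientMap A x)

    x≋0 : x A/x.≈ 0#
    x≋0 = 1# , sym (trans (+-identityˡ _) (*-identityʳ x))

    1≈x-y : ∀ y → 0# ≈ 1# + x * y → x * - y ≈ 1#
    1≈x-y y p = trans (sym (-‿distribʳ-* x y))
      (sym (inverseˡ-unique _ _ (sym p)))
      where open Algebra.Properties.AbelianGroup +-abelianGroup using (inverseˡ-unique)

-- Tensor products and amalgams

module _ {ℓ : Level} {k : CommutativeRing ℓ ℓ} where

  restrictHom : (A : Algebra k) {B : Algebra (Algebra.commutativeRing A)} {C : Algebra k}
    (q : AlgebraHom A C) → AlgebraHom B (along q) → AlgebraHom (restrictScalars A B) C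
  restrictHom A {C = C} q f = record
    { ⟦_⟧                = AlgebraHom.⟦_⟧ f
    ; isRingHomomorphism = AlgebraHom.isRingHomomorphism f
    ; preserves-ι        = λ c → Algebra.trans C
        (AlgebraHom.preserves-ι f (Algebra.ι A c)) (AlgebraHom.preserves-ι q c)
    }

  alongHom : {A B C : Algebra k} (g : AlgebraHom B C) (f : AlgebraHom A B) →
    AlgebraHom (along f) (along (g ∘ₐ f))
  alongHom {C = C} g f = record
    { ⟦_⟧                = AlgebraHom.⟦_⟧ g
    ; isRingHomomorphism = AlgebraHom.isRingHomomorphism g
    ; preserves-ι        = λ a → Algebra.refl C
    }

  structureHom : (A : Algebra k) (B : Algebra (Algebra.commutativeRing A)) →
    AlgebraHom A (restrictScalars A B)
  structureHom A B = record
    { ⟦_⟧                = Algebra.ι B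
    ; isRingHomomorphism = Algebra.isRingHomomorphism B
    ; preserves-ι        = λ c → Algebra.refl B
    }

  module _ (A : Algebra k) where
    open Algebra A hiding (zero)
    open Span A

    -- The joint family g is fixed before the coefficients, as spanning requires; leaving its length
    -- existential avoids splitting `Fin (m + n)`.
    combination-append : ∀ {m n} (e : Vector Carrier m) (f : Vector Carrier n) →
      ∃[ p ] Σ[ g ∈ Vector Carrier p ] ∀ c d → ∃[ b ]
        combination e c + combination f d ≈ combination g b
    combination-append {zero}  {n} e f = n , f , λ c d → d , +-identityˡ _
    combination-append {suc m} {n} e f =
      let (p , g , append) = combination-append (e ∘ suc) f
      in suc p , e zero Vec.∷ g , λ c d →
        let (b , eq) = append (c ∘ suc) d
        in c zero Vec.∷ b , trans (+-assoc _ _ _) (+-congˡ eq)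

  module _ {A : Algebra k} (B : Algebra (Algebra.commutativeRing A)) where
    private
      module A = Algebra A
      module SA = Span A
      module SB = Span B
      B/k = restrictScalars A B
      module SBk = Span B/k
    open Algebra B hiding (zero)
    open IsRingHomomorphism (Algebra.isRingHomomorphism B) using (⟦⟧-cong; 0#-homo; +-homo; *-homo)
    open Relation.Binary.Reasoning.Setoid setoid

    private
      combination-smul : ∀ {m} (e : Vector A.Carrier m) x c →
        ι (SA.combination e c) * x ≈ SBk.combination (λ i → ι (e i) * x) c
      combination-smul {zero}  e x c = trans (*-congʳ 0#-homo) (zeroˡ x)
      combination-smul {suc m} e x c = begin
        ι (A.ι (c zero) A.* e zero A.+ SA.combination (e ∘ suc) (c ∘ suc)) * x
          ≈⟨ *-congʳ (+-homo _ _) ⟩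
        (ι (A.ι (c zero) A.* e zero) + ι (SA.combination (e ∘ suc) (c ∘ suc))) * x
          ≈⟨ distribʳ _ _ _ ⟩
        ι (A.ι (c zero) A.* e zero) * x + ι (SA.combination (e ∘ suc) (c ∘ suc)) * x
          ≈⟨ +-cong (trans (*-congʳ (*-homo _ _)) (*-assoc _ _ _))
                    (combination-smul (e ∘ suc) x (c ∘ suc)) ⟩
        SBk.combination (λ i → ι (e i) * x) c ∎

      -- The generators are the products of the eᵢ with the fⱼ, one block for each fⱼ: a coefficient
      -- in A is expanded in e, and its block is appended to those of the tail.
      towerGenerators : ∀ {m} (e : Vector A.Carrier m) → SA.Spans e →
        ∀ {n} (f : Vector Carrier n) → ∃[ p ] Σ[ g ∈ Vector Carrier p ]
          ∀ c → ∃[ b ] SB.combination f c ≈ SBk.combination g b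
      towerGenerators e e-spans {zero}  f = zero , f , λ c → (λ ()) , refl
      towerGenerators e e-spans {suc n} f =
        let (p , g , tail-spans) = towerGenerators e e-spans (f ∘ suc)
            (q , h , append) = combination-append B/k (λ i → ι (e i) * f zero) g
        in q , h , λ c →
          let (a , c₀≈ea) = e-spans (c zero)
              (d , rest) = tail-spans (c ∘ suc)
              (b , eq) = append a d
          in b , (begin
            ι (c zero) * f zero + SB.combination (f ∘ suc) (c ∘ suc)
              ≈⟨ +-cong (trans (*-congʳ (⟦⟧-cong c₀≈ea)) (combination-smul e (f zero) a)) rest ⟩
            SBk.combination (λ i → ι (e i) * f zero) a + SBk.combination g d
              ≈⟨ eq ⟩
            SBk.combination h b ∎)

    tower-spanned : IsFinitelySpanned A → IsFinitelySpanned B → IsFinitelySpanned B/k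
    tower-spanned (_ , e , e-spans) (_ , f , f-spans) =
      let (p , g , spans) = towerGenerators e e-spans f
      in p , g , λ x →
        let (c , x≈fc) = f-spans x
            (b , fc≈gb) = spans c
        in b , trans x≈fc fc≈gb

  along-spanned : {A B : Algebra k} (f : AlgebraHom A B) →
    IsFinitelySpanned B → IsFinitelySpanned (along f)
  along-spanned {A} {B} f (n , e , spans) = n , e , λ x →
    let (c , x≈ec) = spans x
    in (λ i → Algebra.ι A (c i)) , B.trans x≈ec
      (sum-cong-≋ {n} (λ i → B.*-congʳ (B.sym (AlgebraHom.preserves-ι f (c i)))))
    where
    module B = Algebra B
    open Span B
    open Algebra.Properties.Semiring.Sum B.semiring using (sum-cong-≋)

  -- `tower-spanned` yields B with the structure map of A followed by f; this agrees only pointwise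
  -- with the structure map of B, so the coefficients are carried over by `preserves-ι`.
  spannedVia : {A B : Algebra k} (f : AlgebraHom A B) →
    IsFinitelySpanned A → IsFinitelySpanned (along f) → IsFinitelySpanned B
  spannedVia {A} {B} f A-spanned f-spanned =
    let (n , e , spans) = tower-spanned {A = A} (along f) A-spanned f-spanned
    in n , e , λ x →
      let (c , x≈ec) = spans x
      in c , B.trans x≈ec (sum-cong-≋ {n} (λ i → B.*-congʳ (AlgebraHom.preserves-ι f (c i))))
    where
    module B = Algebra B
    open Algebra.Properties.Semiring.Sum B.semiring using (sum-cong-≋)

  module _ {A B : Algebra k} (f : AlgebraHom A B) where
    private module B = Algebra B
    open AlgebraHom f
    open Algebra.Properties.Semiring.Sum B.semiring using (sum; sum-cong-≋)

    combination-homo : ∀ {n} (e : Vector (Algebra.Carrier A) n) c →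
      ⟦ Span.combination A e c ⟧ B.≈ Span.combination B (⟦_⟧ ∘ e) c
    combination-homo {n} e c = B.trans
      (sum-homo (Algebra.+-commutativeMonoid A) B.+-commutativeMonoid ⟦_⟧ 0#-homo +-homo {n} _)
      (sum-cong-≋ {n} (λ i → B.trans (*-homo _ _) (B.*-congʳ (preserves-ι (c i)))))

module Tensors {ℓ : Level} {k : CommutativeRing ℓ ℓ} (A B : Algebra k) where
  private
    module k = CommutativeRing k
    module A = Algebra A
    module B = Algebra B
  open TensorProduct A B public

  A⊗B : Algebra B.commutativeRing
  A⊗B = ⊗-algebraʳ

  A⊗B/k : Algebra k
  A⊗B/k = restrictScalars B A⊗B

  private module T = Algebra A⊗B

  -- The target is a mere abelian group, so that the construction serves both the ring map `pairing`
  -- and the additive functional in `⊗-nontrivial`.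
  module Lift (Z : AbelianGroup ℓ ℓ)
    (φ : A.Carrier → B.Carrier → AbelianGroup.Carrier Z)
    (φ-cong : ∀ {a a′ b b′} → a A.≈ a′ → b B.≈ b′ → AbelianGroup._≈_ Z (φ a b) (φ a′ b′))
    (φ-addˡ : ∀ a a′ b →
      AbelianGroup._≈_ Z (φ (a A.+ a′) b) (AbelianGroup._∙_ Z (φ a b) (φ a′ b)))
    (φ-addʳ : ∀ a b b′ →
      AbelianGroup._≈_ Z (φ a (b B.+ b′)) (AbelianGroup._∙_ Z (φ a b) (φ a b′)))
    (φ-balance : ∀ c a b → AbelianGroup._≈_ Z (φ (A.ι c A.* a) b) (φ a (B.ι c B.* b)))
    where
    open AbelianGroup Z

    lift : Tensor → Carrier
    lift (a ⊗ b) = φ a b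
    lift 𝟎       = ε
    lift (x ⊕ y) = lift x ∙ lift y
    lift (⊖ x)   = lift x ⁻¹

    lift-cong : ∀ {x y} → x ∼ y → lift x ≈ lift y
    lift-cong ∼-refl            = refl
    lift-cong (∼-sym p)         = sym (lift-cong p)
    lift-cong (∼-trans p q)     = trans (lift-cong p) (lift-cong q)
    lift-cong (⊕-cong p q)      = ∙-cong (lift-cong p) (lift-cong q)
    lift-cong (⊖-cong p)        = ⁻¹-cong (lift-cong p)
    lift-cong (⊕-assoc x y z)   = assoc _ _ _
    lift-cong (⊕-comm x y)      = comm _ _
    lift-cong (⊕-idˡ x)         = identityˡ _
    lift-cong (⊕-invˡ x)        = inverseˡ _
    lift-cong (⊗-cong p q)      = φ-cong p q
    lift-cong (⊗-addˡ a a′ b)   = φ-addˡ a a′ b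
    lift-cong (⊗-addʳ a b b′)   = φ-addʳ a b b′
    lift-cong (⊗-balance c a b) = φ-balance c a b

  leftHom : AlgebraHom A A⊗B/k
  leftHom = record
    { ⟦_⟧                = _⊗ B.1#
    ; isRingHomomorphism = ringHomomorphism A.commutativeRing T.commutativeRing (_⊗ B.1#)
        (λ p → ⊗-cong p B.refl)
        (λ a a′ → ⊗-addˡ a a′ B.1#)
        (λ a a′ → ⊗-cong A.refl (B.sym (B.*-identityˡ B.1#)))
        ∼-refl
    ; preserves-ι        = λ c → ∼-trans (⊗-cong (A.sym (A.*-identityʳ _)) B.refl)
        (∼-trans (⊗-balance c A.1# B.1#) (⊗-cong A.refl (B.*-identityʳ _)))
    }

  ⊗-factor : ∀ a b → a ⊗ b ∼ (a ⊗ B.1#) · (A.1# ⊗ b)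
  ⊗-factor a b = ⊗-cong (A.sym (A.*-identityʳ a)) (B.sym (B.*-identityˡ b))

  -- Bare ring homomorphisms are compared because `twist` needs this for maps that are B-linear with
  -- respect to two structure maps on the target which agree only pointwise.
  ringHom-ext : (R : CommutativeRing ℓ ℓ) → let open CommutativeRing R using (_≈_; rawRing) in
    ∀ {f g} → IsRingHomomorphism T.rawRing rawRing f → IsRingHomomorphism T.rawRing rawRing g →
    (∀ a → f (a ⊗ B.1#) ≈ g (a ⊗ B.1#)) → (∀ b → f (A.1# ⊗ b) ≈ g (A.1# ⊗ b)) →
    ∀ x → f x ≈ g x
  ringHom-ext R {f} {g} f-hom g-hom agreeˡ agreeʳ = go
    where
    module R = CommutativeRing R
    module f = IsRingHomomorphism f-hom
    module g = IsRingHomomorphism g-hom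
    open Relation.Binary.Reasoning.Setoid R.setoid

    go : ∀ x → f x R.≈ g x
    go (a ⊗ b) = begin
      f (a ⊗ b)                        ≈⟨ f.⟦⟧-cong (⊗-factor a b) ⟩
      f ((a ⊗ B.1#) · (A.1# ⊗ b))      ≈⟨ f.*-homo (a ⊗ B.1#) (A.1# ⊗ b) ⟩
      f (a ⊗ B.1#) R.* f (A.1# ⊗ b)    ≈⟨ R.*-cong (agreeˡ a) (agreeʳ b) ⟩
      g (a ⊗ B.1#) R.* g (A.1# ⊗ b)    ≈⟨ g.*-homo (a ⊗ B.1#) (A.1# ⊗ b) ⟨
      g ((a ⊗ B.1#) · (A.1# ⊗ b))      ≈⟨ g.⟦⟧-cong (⊗-factor a b) ⟨
      g (a ⊗ b)                        ∎
    go 𝟎       = R.trans f.0#-homo (R.sym g.0#-homo)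
    go (x ⊕ y) = R.trans (f.+-homo x y)
      (R.trans (R.+-cong (go x) (go y)) (R.sym (g.+-homo x y)))
    go (⊖ x)   = R.trans (f.-‿homo x) (R.trans (R.-‿cong (go x)) (R.sym (g.-‿homo x)))

  hom-ext : {D : Algebra B.commutativeRing} (f g : AlgebraHom A⊗B D) →
    (∀ a → Algebra._≈_ D (AlgebraHom.⟦_⟧ f (a ⊗ B.1#)) (AlgebraHom.⟦_⟧ g (a ⊗ B.1#))) →
    ∀ x → Algebra._≈_ D (AlgebraHom.⟦_⟧ f x) (AlgebraHom.⟦_⟧ g x)
  hom-ext {D} f g agree =
    ringHom-ext (Algebra.commutativeRing D)
      (AlgebraHom.isRingHomomorphism f) (AlgebraHom.isRingHomomorphism g) agree
      (λ b → Algebra.trans D (AlgebraHom.preserves-ι f b) (Algebra.sym D (AlgebraHom.preserves-ι g b)))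

  module _ {C : Algebra k} (p : AlgebraHom A C) (q : AlgebraHom B C) where
    private
      module C = Algebra C
      module p = AlgebraHom p
      module q = AlgebraHom q
      open Relation.Binary.Reasoning.Setoid C.setoid
      open Algebra.Properties.Ring C.ring using (-‿distribˡ-*; -‿distribʳ-*)
      open Algebra.Properties.CommutativeSemigroup C.*-commutativeSemigroup using (interchange)

      open Lift C.+-abelianGroup (λ a b → p.⟦ a ⟧ C.* q.⟦ b ⟧)
        (λ r s → C.*-cong (p.⟦⟧-cong r) (q.⟦⟧-cong s))
        (λ a a′ b → C.trans (C.*-congʳ (p.+-homo a a′)) (C.distribʳ _ _ _))
        (λ a b b′ → C.trans (C.*-congˡ (q.+-homo b b′)) (C.distribˡ _ _ _))
        (λ c a b → begin
          p.⟦ A.ι c A.* a ⟧ C.* q.⟦ b ⟧            ≈⟨ C.*-congʳ (p.*-homo _ _) ⟩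
          (p.⟦ A.ι c ⟧ C.* p.⟦ a ⟧) C.* q.⟦ b ⟧    ≈⟨ C.*-congʳ (C.*-comm _ _) ⟩
          (p.⟦ a ⟧ C.* p.⟦ A.ι c ⟧) C.* q.⟦ b ⟧    ≈⟨ C.*-assoc _ _ _ ⟩
          p.⟦ a ⟧ C.* (p.⟦ A.ι c ⟧ C.* q.⟦ b ⟧)    ≈⟨ C.*-congˡ (C.*-congʳ
                                                        (C.trans (p.preserves-ι c) (C.sym (q.preserves-ι c)))) ⟩
          p.⟦ a ⟧ C.* (q.⟦ B.ι c ⟧ C.* q.⟦ b ⟧)    ≈⟨ C.*-congˡ (q.*-homo _ _) ⟨
          p.⟦ a ⟧ C.* q.⟦ B.ι c B.* b ⟧            ∎)

      lift-scale : ∀ a b x → lift (scale a b x) C.≈ (p.⟦ a ⟧ C.* q.⟦ b ⟧) C.* lift x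
      lift-scale a b (c ⊗ d) =
        C.trans (C.*-cong (p.*-homo a c) (q.*-homo b d)) (interchange _ _ _ _)
      lift-scale a b 𝟎       = C.sym (C.zeroʳ _)
      lift-scale a b (x ⊕ y) =
        C.trans (C.+-cong (lift-scale a b x) (lift-scale a b y)) (C.sym (C.distribˡ _ _ _))
      lift-scale a b (⊖ x)   = C.trans (C.-‿cong (lift-scale a b x)) (-‿distribʳ-* _ _)

      lift-· : ∀ x y → lift (x · y) C.≈ lift x C.* lift y
      lift-· (a ⊗ b) y = lift-scale a b y
      lift-· 𝟎       y = C.sym (C.zeroˡ _)
      lift-· (x ⊕ z) y = C.trans (C.+-cong (lift-· x y) (lift-· z y)) (C.sym (C.distribʳ _ _ _))
      lift-· (⊖ x)   y = C.trans (C.-‿cong (lift-· x y)) (-‿distribˡ-* _ _)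

    opaque
      -- The map a ⊗ b ↦ p(a) q(b), that is, extension of scalars: p becomes B-linear once C is
      -- viewed through q. This turns embeddings of E into L-embeddings of E ⊗ L; uniqueness is
      -- `hom-ext`.
      pairing : AlgebraHom A⊗B (along q)
      pairing = record
        { ⟦_⟧                = lift
        ; isRingHomomorphism = ringHomomorphism T.commutativeRing C.commutativeRing lift
            lift-cong (λ x y → C.refl) lift-·
            (C.trans (C.*-cong p.1#-homo q.1#-homo) (C.*-identityˡ C.1#))
        ; preserves-ι        = λ b → C.trans (C.*-congʳ p.1#-homo) (C.*-identityˡ _)
        }

      pairing-left : ∀ a → AlgebraHom.⟦_⟧ pairing (a ⊗ B.1#) C.≈ p.⟦ a ⟧
      pairing-left a = C.trans (C.*-congˡ q.1#-homo) (C.*-identityʳ _)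

  -- a ⊗ b = Σ (1 ⊗ cᵢb)(eᵢ ⊗ 1) for a = Σ cᵢeᵢ.
  ⊗-spans : ∀ {n} (e : Vector A.Carrier n) → Span.Spans A e →
    Span.Spans A⊗B (λ i → e i ⊗ B.1#)
  ⊗-spans {n} e spans = go
    where
    module S = Span A⊗B
    open Relation.Binary.Reasoning.Setoid T.setoid
    open Algebra.Properties.Semiring.Sum T.semiring using (sum; sum-cong-≋)

    1⊗_ = T.ι
    e⊗1 : Vector Tensor n
    e⊗1 i = e i ⊗ B.1#

    term : ∀ c a b → (A.ι c A.* a) ⊗ b ∼ (A.1# ⊗ (B.ι c B.* b)) · (a ⊗ B.1#)
    term c a b = ∼-trans (⊗-balance c a b)
      (⊗-cong (A.sym (A.*-identityˡ a)) (B.sym (B.*-identityʳ _)))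

    0⊗ : ∀ b → A.0# ⊗ b ∼ 𝟎
    0⊗ b = identityˡ-unique _ _
      (∼-trans (∼-sym (⊗-addˡ A.0# A.0# b)) (⊗-cong (A.+-identityˡ A.0#) B.refl))
      where open Algebra.Properties.AbelianGroup ⊕-abelianGroup using (identityˡ-unique)

    go : ∀ x → ∃[ c ] x ∼ S.combination e⊗1 c
    go (a ⊗ b) = let (c , a≈ec) = spans a in (λ i → B.ι (c i) B.* b) , (begin
      a ⊗ b                                 ≈⟨ ⊗-cong a≈ec B.refl ⟩
      Span.combination A e c ⊗ b            ≈⟨ sum-homo A.+-commutativeMonoid T.+-commutativeMonoid
                                                 (_⊗ b) (0⊗ b) (λ x y → ⊗-addˡ x y b) {n} _ ⟩
      sum {n} (λ i → (A.ι (c i) A.* e i) ⊗ b) ≈⟨ sum-cong-≋ {n} (λ i → term (c i) (e i) b) ⟩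
      S.combination e⊗1 (λ i → B.ι (c i) B.* b) ∎)
    go 𝟎       = (λ _ → B.0#) , ∼-sym (S.combination-0 e⊗1 (λ _ → B.refl))
    go (x ⊕ y) =
      let (c , x≈c) = go x
          (d , y≈d) = go y
      in _ , (begin
        x ⊕ y
          ≈⟨ ⊕-cong x≈c (∼-trans y≈d (∼-sym (T.*-identityˡ _))) ⟩
        S.combination e⊗1 c ⊕ (1⊗ B.1#) · S.combination e⊗1 d
          ≈⟨ S.combination-linear e⊗1 B.1# d c ⟨
        S.combination e⊗1 (λ i → c i B.+ B.1# B.* d i) ∎)
    go (⊖ x)   =
      let (c , x≈c) = go x
      in _ , (begin
        ⊖ x                             ≈⟨ T.-‿cong x≈c ⟩
        ⊖ S.combination e⊗1 c           ≈⟨ ⊕-idˡ _ ⟨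
        𝟎 ⊕ ⊖ S.combination e⊗1 c       ≈⟨ ⊕-cong (S.combination-0 e⊗1 (λ _ → B.refl))
                                             (∼-trans (T.*-congʳ {x = S.combination e⊗1 c} ι-neg) (-1*x≈-x _)) ⟨
        S.combination e⊗1 (λ _ → B.0#) ⊕ (1⊗ (B.- B.1#)) · S.combination e⊗1 c
          ≈⟨ S.combination-linear e⊗1 (B.- B.1#) c (λ _ → B.0#) ⟨
        S.combination e⊗1 (λ i → B.0# B.+ (B.- B.1#) B.* c i) ∎)
      where
      open Algebra.Properties.Ring T.ring using (-1*x≈-x)
      ι-neg : 1⊗ (B.- B.1#) ∼ ⊖ (1⊗ B.1#)
      ι-neg = IsRingHomomorphism.-‿homo T.isRingHomomorphism B.1#

  -- A coordinate function not vanishing at 1 ∈ A detects 1 ⊗ 1.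
  ⊗-nontrivial : ExcludedMiddle ℓ → IsField k → IsFiniteDimensional A →
    ¬ (A.0# A.≈ A.1#) → ¬ (B.0# B.≈ B.1#) → ¬ (𝟎 ∼ A.1# ⊗ B.1#)
  ⊗-nontrivial em k-isField (n , e , spans , unique) 0≉1ᴬ 0≉1ᴮ 0∼1⊗1
    with em {∃[ i ] ¬ (proj₁ (spans A.1#) i k.≈ k.0#)}
  ... | no allZero = 0≉1ᴬ (A.sym (A.trans (proj₂ (spans A.1#))
    (Span.combination-0 A e (λ i → decidable-stable em (λ cᵢ≉0 → allZero (i , cᵢ≉0))))))
  ... | yes (i , λ1≉0) = 0≉1ᴮ (begin
    B.0#                        ≈⟨ B.zeroʳ _ ⟨
    B.ι u B.* B.0#              ≈⟨ B.*-congˡ (lift-cong 0∼1⊗1) ⟩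
    B.ι u B.* (B.ι (λᵢ A.1#) B.* B.1#) ≈⟨ B.*-congˡ (B.*-identityʳ _) ⟩
    B.ι u B.* B.ι (λᵢ A.1#)     ≈⟨ ιB.*-homo _ _ ⟨
    B.ι (u k.* λᵢ A.1#)         ≈⟨ ιB.⟦⟧-cong uλ1≈1 ⟩
    B.ι k.1#                    ≈⟨ ιB.1#-homo ⟩
    B.1#                        ∎)
    where
    module SA = Span A
    module ιB = IsRingHomomorphism B.isRingHomomorphism
    module ιA = IsRingHomomorphism A.isRingHomomorphism
    open Relation.Binary.Reasoning.Setoid B.setoid

    coordinate : A.Carrier → Vector k.Carrier n
    coordinate a = proj₁ (spans a)

    λᵢ : A.Carrier → k.Carrier
    λᵢ a = coordinate a i

    u = proj₁ (Field.inverse k k-isField λ1≉0)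
    uλ1≈1 = proj₂ (Field.inverse k k-isField λ1≉0)

    λ-unique : ∀ {a} c → a A.≈ SA.combination e c → λᵢ a k.≈ c i
    λ-unique {a} c p = unique _ c (A.trans (A.sym (proj₂ (spans a))) p) i

    λ-cong : ∀ {a b} → a A.≈ b → λᵢ a k.≈ λᵢ b
    λ-cong {b = b} p = λ-unique (coordinate b) (A.trans p (proj₂ (spans b)))

    λ-linear : ∀ r a b → λᵢ (a A.+ A.ι r A.* b) k.≈ λᵢ a k.+ r k.* λᵢ b
    λ-linear r a b = λ-unique _ (A.trans
      (A.+-cong (proj₂ (spans a)) (A.*-congˡ (proj₂ (spans b))))
      (A.sym (SA.combination-linear e r (coordinate b) (coordinate a))))

    λ-0 : λᵢ A.0# k.≈ k.0#
    λ-0 = λ-unique (λ _ → k.0#) (A.sym (SA.combination-0 e (λ _ → k.refl)))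

    λ-add : ∀ a b → λᵢ (a A.+ b) k.≈ λᵢ a k.+ λᵢ b
    λ-add a b = k.trans
      (λ-cong (A.+-congˡ (A.sym (A.trans (A.*-congʳ ιA.1#-homo) (A.*-identityˡ b)))))
      (k.trans (λ-linear k.1# a b) (k.+-congˡ (k.*-identityˡ _)))

    λ-scale : ∀ r b → λᵢ (A.ι r A.* b) k.≈ r k.* λᵢ b
    λ-scale r b = k.trans (λ-cong (A.sym (A.+-identityˡ _)))
      (k.trans (λ-linear r A.0# b) (k.trans (k.+-congʳ λ-0) (k.+-identityˡ _)))

    open Lift B.+-abelianGroup (λ a b → B.ι (λᵢ a) B.* b)
      (λ p q → B.*-cong (ιB.⟦⟧-cong (λ-cong p)) q)
      (λ a a′ b → B.trans (B.*-congʳ (B.trans (ιB.⟦⟧-cong (λ-add a a′)) (ιB.+-homo _ _)))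
        (B.distribʳ _ _ _))
      (λ a b b′ → B.distribˡ _ _ _)
      (λ c a b → begin
        B.ι (λᵢ (A.ι c A.* a)) B.* b      ≈⟨ B.*-congʳ (ιB.⟦⟧-cong (k.trans (λ-scale c a) (k.*-comm _ _))) ⟩
        B.ι (λᵢ a k.* c) B.* b            ≈⟨ B.*-congʳ (ιB.*-homo _ _) ⟩
        (B.ι (λᵢ a) B.* B.ι c) B.* b      ≈⟨ B.*-assoc _ _ _ ⟩
        B.ι (λᵢ a) B.* (B.ι c B.* b)      ∎)

module _ {ℓ : Level} {k : CommutativeRing ℓ ℓ} (em : ExcludedMiddle ℓ) (k-isField : IsField k) where

  -- The field `spanned` makes Ω finite over B. It is kept so that an amalgam finite over k can
  -- itself be amalgamated again.
  record Amalgam (A B : Algebra k) : Set (sucℓ ℓ) where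
    field
      Ω         : Algebra k
      Ω-isField : IsField (Algebra.commutativeRing Ω)
      left      : AlgebraHom A Ω
      right     : AlgebraHom B Ω
      spanned   : IsFinitelySpanned (along right)

  opaque
    -- Any residue field of A ⊗ B will do. The tensor product is nonzero and finite over the field
    -- B, so `fieldQuotient` reaches such a field in finitely many steps.
    amalgam : (A B : Algebra k) → IsFinitelySpanned A →
      ¬ (Algebra._≈_ A (Algebra.0# A) (Algebra.1# A)) →
      IsField (Algebra.commutativeRing B) → Amalgam A B
    amalgam A B A-spanned@(n , e , spans) A-nontrivial B-isField =
      let open Tensors A B
          (Q , Q-isField , Q-spanned , h) = fieldQuotient em B-isField n A⊗B
            (λ i → e i ⊗ Algebra.1# B) (⊗-spans e spans)
            (⊗-nontrivial em k-isField (spanned⇒finiteDimensional em k-isField A A-spanned)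
              A-nontrivial (proj₁ B-isField))
      in record
        { Ω         = restrictScalars B Q
        ; Ω-isField = Q-isField
        ; left      = restrictHom B (structureHom B Q) h ∘ₐ leftHom
        ; right     = structureHom B Q
        ; spanned   = Q-spanned
        }

-- Conjugacy of embeddings of a Galois extension

module _ {ℓ : Level} (em : ExcludedMiddle ℓ)
  (R : CommutativeRing ℓ ℓ) (R-isField : IsField R) where
  open CommutativeRing R hiding (zero)
  open Algebra.Properties.Semiring.Sum semiring
  open Algebra.Properties.Ring ring using (-‿distribˡ-*)
  open Algebra.Properties.AbelianGroup +-abelianGroup using (inverseʳ-unique)
  open Relation.Binary.Reasoning.Setoid setoid

  dot : ∀ {n} → Vector Carrier n → Vector Carrier n → Carrier
  dot x y = sum (λ i → x i * y i)

  private
    dot-linear : ∀ {n} (x y v : Vector Carrier n) a →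
      dot (λ i → x i + a * y i) v ≈ dot x v + a * dot y v
    dot-linear {n} x y v a = begin
      dot (λ i → x i + a * y i) v
        ≈⟨ sum-cong-≋ {n} (λ i → trans (distribʳ _ _ _) (+-congˡ (*-assoc _ _ _))) ⟩
      sum {n} (λ i → x i * v i + a * (y i * v i))
        ≈⟨ ∑-distrib-+ {n} _ _ ⟩
      dot x v + sum {n} (λ i → a * (y i * v i))
        ≈⟨ +-congˡ (*-distribˡ-sum {n} a _) ⟨
      dot x v + a * dot y v ∎

  -- Gaussian elimination, one pivot form for each coordinate.
  finiteSubsystem : ∀ {I : Set ℓ} n (φ : I → Vector Carrier n) →
    Σ[ S ∈ List I ] ∀ v → All (λ s → dot (φ s) v ≈ 0#) S → ∀ t → dot (φ t) v ≈ 0#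
  finiteSubsystem zero    φ = [] , λ v _ t → refl
  finiteSubsystem {I} (suc n) φ with em {∃[ s ] ¬ (φ s zero ≈ 0#)}
  ... | no allZero =
    let (S , S-determines) = finiteSubsystem n (λ t → φ t ∘ suc)
    in S , λ v zeros t → trans (dot-tail v t)
      (S-determines (v ∘ suc) (All.map (λ {s} p → trans (sym (dot-tail v s)) p) zeros) t)
    where
    dot-tail : ∀ v t → dot (φ t) v ≈ dot (φ t ∘ suc) (v ∘ suc)
    dot-tail v t = trans
      (+-congʳ (trans (*-congʳ (decidable-stable em (λ p → allZero (t , p)))) (zeroˡ _)))
      (+-identityˡ _)
  ... | yes (s , pivot≉0) =
    let (S , S-determines) = finiteSubsystem n ψ
    in s ∷ S , λ { v (z ∷ zeros) t → trans (sym (eliminated v z t))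
         (S-determines (v ∘ suc) (All.map (λ {r} p → trans (eliminated v z r) p) zeros) t) }
    where
    u = proj₁ (Field.inverse R R-isField pivot≉0)

    ψ : I → Vector Carrier n
    ψ t i = φ t (suc i) + - (φ t zero * u) * φ s (suc i)

    -- On solutions of the pivot form, its tail equals minus its leading term, so subtracting the
    -- multiple of the tail restores exactly the leading term of `φ t`.
    eliminated : ∀ v → dot (φ s) v ≈ 0# → ∀ t → dot (ψ t) (v ∘ suc) ≈ dot (φ t) v
    eliminated v z t = begin
      dot (ψ t) (v ∘ suc)
        ≈⟨ dot-linear _ _ (v ∘ suc) _ ⟩
      dot (φ t ∘ suc) (v ∘ suc) + - (φ t zero * u) * dot (φ s ∘ suc) (v ∘ suc)
        ≈⟨ +-congˡ (*-congˡ (inverseʳ-unique _ _ z)) ⟩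
      dot (φ t ∘ suc) (v ∘ suc) + - (φ t zero * u) * - (φ s zero * v zero)
        ≈⟨ +-congˡ neg*neg ⟩
      dot (φ t ∘ suc) (v ∘ suc) + (φ t zero * u) * (φ s zero * v zero)
        ≈⟨ +-congˡ (*-assoc _ _ _) ⟩
      dot (φ t ∘ suc) (v ∘ suc) + φ t zero * (u * (φ s zero * v zero))
        ≈⟨ +-congˡ (*-congˡ (trans (sym (*-assoc _ _ _))
             (trans (*-congʳ (proj₂ (Field.inverse R R-isField pivot≉0))) (*-identityˡ _)))) ⟩
      dot (φ t ∘ suc) (v ∘ suc) + φ t zero * v zero
        ≈⟨ +-comm _ _ ⟩
      dot (φ t) v ∎
      where
      open Algebra.Properties.Ring ring using (-‿distribʳ-*)
      open Algebra.Properties.AbelianGroup +-abelianGroup using (⁻¹-involutive)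
      neg*neg : ∀ {x y} → - x * - y ≈ x * y
      neg*neg {x} {y} = trans (sym (-‿distribˡ-* x (- y)))
        (trans (-‿cong (sym (-‿distribʳ-* x y))) (⁻¹-involutive _))

module _ {ℓ : Level} {k : CommutativeRing ℓ ℓ} where

  automorphismHom : {M : Algebra k} → Automorphism M → AlgebraHom M M
  automorphismHom σ = record
    { ⟦_⟧                = Automorphism.⟦_⟧ σ
    ; isRingHomomorphism = Automorphism.isRingHomomorphism σ
    ; preserves-ι        = Automorphism.fixes-base σ
    }

module Galois {ℓ : Level} (em : ExcludedMiddle ℓ) {k : CommutativeRing ℓ ℓ}
  (M : Algebra k) (M-isGalois : IsGaloisExtension M) where
  private module k = CommutativeRing k
  open Algebra M hiding (zero)
  open IsGaloisExtension M-isGalois using (isFiniteFieldExtension; fixed-by-all⇒base)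
  open IsFiniteFieldExtension isFiniteFieldExtension
  open Algebra.Properties.Semiring.Sum semiring
  private module Γ = Group (Aut M)

  ⟦_⟧ : Automorphism M → Carrier → Carrier
  ⟦_⟧ = Automorphism.⟦_⟧

  -- Artin's argument: normalise v₀ = 1; then σv − v has a zero in position 0,
  -- so v is Γ-invariant.
  descent : ∀ n (V : Vector Carrier n → Set ℓ) →
    (∀ {v w} → (∀ i → v i ≈ w i) → V v → V w) →
    V (λ _ → 0#) →
    (∀ a {v w} → V v → V w → V (λ i → v i + a * w i)) →
    (∀ σ {v} → V v → V (⟦ σ ⟧ ∘ v)) →
    (∀ c → V (ι ∘ c) → ∀ i → ι (c i) ≈ 0#) →
    ∀ {v} → V v → ∀ i → v i ≈ 0#
  descent (suc n) V resp V0 linear stable noBasePoints {v} Vv = splitHead em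
    where
    open Algebra.Properties.AbelianGroup +-abelianGroup using (x∙y⁻¹≈ε⇒x≈y)
    open Algebra.Properties.Ring ring using (-1*x≈-x)

    -- The induction on n runs through the vectors of V with zero head, which form a space of the
    -- same kind with one coordinate less.
    V₀ : Vector Carrier n → Set ℓ
    V₀ w = V (0# Vec.∷ w)

    V₀-zero : ∀ {w} → V₀ w → ∀ i → w i ≈ 0#
    V₀-zero = descent n V₀
      (λ p → resp (λ { zero → refl ; (suc i) → p i }))
      (resp (λ { zero → refl ; (suc i) → refl }) V0)
      (λ a p q → resp (λ { zero → trans (+-identityˡ _) (zeroʳ a) ; (suc i) → refl }) (linear a p q))
      (λ σ p → resp (λ { zero → Automorphism.0#-homo σ ; (suc i) → refl }) (stable σ p))
      (λ c p i → noBasePoints (k.0# Vec.∷ c)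
        (resp (λ { zero → sym (IsRingHomomorphism.0#-homo isRingHomomorphism) ; (suc i) → refl }) p)
        (suc i))

    headZero⇒zero : ∀ {w} → V w → w zero ≈ 0# → ∀ i → w i ≈ 0#
    headZero⇒zero Vw w₀≈0 zero    = w₀≈0
    headZero⇒zero Vw w₀≈0 (suc i) =
      V₀-zero (resp (λ { zero → w₀≈0 ; (suc _) → refl }) Vw) i

    splitHead : Dec (v zero ≈ 0#) → ∀ i → v i ≈ 0#
    splitHead (yes v₀≈0) = headZero⇒zero Vv v₀≈0
    -- The normalised vector w is fixed by Γ, so it has coordinates in k and vanishes by
    -- `noBasePoints`, although its head is 1.
    splitHead (no  v₀≉0) = contradiction
      (trans (sym (noBasePoints (proj₁ ∘ w-invariant) (resp (proj₂ ∘ w-invariant) Vw) zero))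
        (trans (sym (proj₂ (w-invariant zero))) w₀≈1))
      (proj₁ isField)
      where
      u = proj₁ (Field.inverse commutativeRing isField v₀≉0)

      w : Vector Carrier (suc n)
      w i = u * v i

      w₀≈1 : w zero ≈ 1#
      w₀≈1 = proj₂ (Field.inverse commutativeRing isField v₀≉0)

      Vw : V w
      Vw = resp (λ i → +-identityˡ _) (linear u V0 Vv)

      w-fixed : ∀ i σ → ⟦ σ ⟧ (w i) ≈ w i
      w-fixed i σ = x∙y⁻¹≈ε⇒x≈y _ _ (headZero⇒zero
        (resp (λ i → +-congˡ (-1*x≈-x _)) (linear (- 1#) (stable σ Vw) Vw))
        (trans
          (+-cong (trans (Automorphism.⟦⟧-cong σ w₀≈1) (Automorphism.1#-homo σ)) (-‿cong w₀≈1))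
          (-‿inverseʳ 1#))
        i)

      w-invariant : ∀ i → ∃[ c ] w i ≈ ι c
      w-invariant i = fixed-by-all⇒base (w i) (w-fixed i)

  private
    module T = Tensors M M
    open T using (A⊗B; _∼_; _⊗_; _·_; 𝟎; ⊖_; _⊕_)
    module A⊗B = Algebra A⊗B

    self : Algebra commutativeRing
    self = along {A = M} {B = M} idₐ

    module S = Span self

    n = proj₁ isFiniteDimensional
    e = proj₁ (proj₂ isFiniteDimensional)
    spans = proj₁ (proj₂ (proj₂ isFiniteDimensional))
    unique = proj₂ (proj₂ (proj₂ isFiniteDimensional))

    _⊗1 : Carrier → T.Tensor
    x ⊗1 = x ⊗ 1#

    -- The map x ⊗ y ↦ σ(x) y. Together these are the components of the classical isomorphism from M
    -- ⊗ M to a product of copies of M indexed by Γ; only its injectivity is established below.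
    twistedMultiplication : Automorphism M → AlgebraHom A⊗B self
    twistedMultiplication σ = T.pairing (automorphismHom σ) idₐ

    module m σ = AlgebraHom (twistedMultiplication σ)

    m-combination : ∀ σ v → m.⟦_⟧ σ (Span.combination A⊗B (_⊗1 ∘ e) v) ≈
      S.combination (⟦ σ ⟧ ∘ e) v
    m-combination σ v = trans (combination-homo (twistedMultiplication σ) (_⊗1 ∘ e) v)
      (sum-cong-≋ {n} (λ i → *-congˡ (T.pairing-left (automorphismHom σ) idₐ (e i))))

    Annihilated : Vector Carrier n → Set ℓ
    Annihilated v = ∀ σ → S.combination (⟦ σ ⟧ ∘ e) v ≈ 0#

    -- `descent` applies: the relation of τv at σ is τ applied to the relation of v at τ⁻¹σ, which
    -- gives stability; and for v with coordinates in k the relation at the identity is a k-linear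
    -- relation among the basis e, so v vanishes.
    annihilated⇒0 : ∀ {v} → Annihilated v → ∀ i → v i ≈ 0#
    annihilated⇒0 = descent n Annihilated
      (λ p Vv σ → trans (S.combination-cong (⟦ σ ⟧ ∘ e) (λ i → sym (p i))) (Vv σ))
      (λ σ → S.combination-0 (⟦ σ ⟧ ∘ e) (λ _ → refl))
      (λ a {v} {w} Vv Vw σ → trans (S.combination-linear (⟦ σ ⟧ ∘ e) a w v)
        (trans (+-cong (Vv σ) (trans (*-congˡ (Vw σ)) (zeroʳ a))) (+-identityˡ 0#)))
      (λ τ {v} Vv σ → begin
        S.combination (⟦ σ ⟧ ∘ e) (⟦ τ ⟧ ∘ v)
          ≈⟨ sum-cong-≋ {n} (λ i → trans (Automorphism.*-homo τ _ _)
               (*-congˡ (Γ.inverseʳ τ (⟦ σ ⟧ (e i))))) ⟨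
        sum {n} (λ i → ⟦ τ ⟧ (v i * ⟦ τ Γ.⁻¹ Γ.∙ σ ⟧ (e i)))
          ≈⟨ sum-homo +-commutativeMonoid +-commutativeMonoid ⟦ τ ⟧
               (Automorphism.0#-homo τ) (Automorphism.+-homo τ) {n} _ ⟨
        ⟦ τ ⟧ (S.combination (⟦ τ Γ.⁻¹ Γ.∙ σ ⟧ ∘ e) v)
          ≈⟨ Automorphism.⟦⟧-cong τ (Vv (τ Γ.⁻¹ Γ.∙ σ)) ⟩
        ⟦ τ ⟧ 0#
          ≈⟨ Automorphism.0#-homo τ ⟩
        0# ∎)
      (λ c Vc i → trans
        (IsRingHomomorphism.⟦⟧-cong isRingHomomorphism
          (unique c (λ _ → k.0#)
            (trans (Vc Γ.ε) (sym (Span.combination-0 M e (λ _ → k.refl)))) i))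
        (IsRingHomomorphism.0#-homo isRingHomomorphism))
      where open Relation.Binary.Reasoning.Setoid setoid

    killedByAll⇒0 : ∀ z → (∀ σ → m.⟦_⟧ σ z ≈ 0#) → z ∼ 𝟎
    killedByAll⇒0 z killed =
      let (v , z∼ev) = T.⊗-spans e spans z
      in A⊗B.trans z∼ev (Span.combination-0 A⊗B (_⊗1 ∘ e)
           (annihilated⇒0 λ σ → trans (sym (m-combination σ v))
             (trans (sym (m.⟦⟧-cong σ z∼ev)) (killed σ))))

    -- The product formed in `conjugate` needs a finite list. Being killed by every σ is a linear
    -- system in the n coordinates of z, so finitely many σ imply the rest.
    finitelyManyKill : Σ[ S ∈ List (Automorphism M) ]
      ∀ z → All (λ σ → m.⟦_⟧ σ z ≈ 0#) S → ∀ τ → m.⟦_⟧ τ z ≈ 0#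
    finitelyManyKill =
      let (S , S-determines) = finiteSubsystem em commutativeRing isField n (λ σ → ⟦ σ ⟧ ∘ e)
      in S , λ z killed τ →
        let (v , z∼ev) = T.⊗-spans e spans z
            m≈dot : ∀ σ → m.⟦_⟧ σ z ≈ dot em commutativeRing isField (⟦ σ ⟧ ∘ e) v
            m≈dot σ = trans (m.⟦⟧-cong σ z∼ev)
              (trans (m-combination σ v) (sum-cong-≋ {n} (λ i → *-comm _ _)))
        in trans (m≈dot τ) (S-determines v (All.map (λ {σ} p → trans (sym (m≈dot σ)) p) killed) τ)

  opaque
    -- If q differs from every p ∘ σ, say at x_σ, then the product of the
    -- elements x_σ ⊗ 1 − 1 ⊗ σ(x_σ) over finitely many σ is killed by all
    -- x ⊗ y ↦ σ(x) y, hence 0; but x ⊗ y ↦ q(x) p(y) does not kill it.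
    conjugate : (Ω : Algebra k) → IsField (Algebra.commutativeRing Ω) →
      (p q : AlgebraHom M Ω) →
      ∃[ σ ] ∀ x → Algebra._≈_ Ω (AlgebraHom.⟦_⟧ q x) (AlgebraHom.⟦_⟧ p (⟦ σ ⟧ x))
    conjugate Ω Ω-isField p q = decidable-stable em λ notConjugate →
      let witness : ∀ σ → ∃[ x ] ¬ (q.⟦ x ⟧ Ω.≈ p.⟦ ⟦ σ ⟧ x ⟧)
          witness σ = decidable-stable em λ none →
            notConjugate (σ , λ x → decidable-stable em λ differ → none (x , differ))
      in absurd (proj₁ ∘ witness) (proj₂ ∘ witness)
      where
      module Ω = Algebra Ω
      module p = AlgebraHom p
      module q = AlgebraHom q
      module ev = AlgebraHom (T.pairing q p)

      module _ (x : Automorphism M → Carrier)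
        (differ : ∀ σ → ¬ (q.⟦ x σ ⟧ Ω.≈ p.⟦ ⟦ σ ⟧ (x σ) ⟧)) where

        factor : Automorphism M → T.Tensor
        factor σ = x σ ⊗ 1# ⊕ ⊖ (1# ⊗ ⟦ σ ⟧ (x σ))

        product : List (Automorphism M) → T.Tensor
        product []      = A⊗B.1#
        product (σ ∷ S) = factor σ · product S

        factor-killed : ∀ σ → m.⟦_⟧ σ (factor σ) ≈ 0#
        factor-killed σ = trans (m.+-homo σ _ _) (trans
          (+-cong (T.pairing-left (automorphismHom σ) idₐ (x σ))
            (trans (m.-‿homo σ _) (-‿cong (m.preserves-ι σ (⟦ σ ⟧ (x σ))))))
          (-‿inverseʳ _))

        product-killed : ∀ S → All (λ σ → m.⟦_⟧ σ (product S) ≈ 0#) S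
        product-killed []      = []
        product-killed (σ ∷ S) =
          trans (m.*-homo σ (factor σ) (product S)) (trans (*-congʳ (factor-killed σ)) (zeroˡ _)) ∷
          All.map (λ {τ} r → trans (m.*-homo τ (factor σ) (product S)) (trans (*-congˡ r) (zeroʳ _)))
            (product-killed S)

        factor-survives : ∀ σ → ¬ (ev.⟦ factor σ ⟧ Ω.≈ Ω.0#)
        factor-survives σ r = differ σ (x∙y⁻¹≈ε⇒x≈y _ _ (Ω.trans
          (Ω.sym (Ω.trans (ev.+-homo _ _) (Ω.+-cong (T.pairing-left q p (x σ))
            (Ω.trans (ev.-‿homo _) (Ω.-‿cong (ev.preserves-ι (⟦ σ ⟧ (x σ))))))))
          r))
          where open Algebra.Properties.AbelianGroup Ω.+-abelianGroup using (x∙y⁻¹≈ε⇒x≈y)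

        product-survives : ∀ S → ¬ (ev.⟦ product S ⟧ Ω.≈ Ω.0#)
        product-survives []      r = proj₁ Ω-isField (Ω.trans (Ω.sym r) ev.1#-homo)
        product-survives (σ ∷ S) r = product-survives S
          (Field.*-cancelˡ-0 Ω.commutativeRing Ω-isField (factor-survives σ)
            (Ω.trans (Ω.sym (ev.*-homo (factor σ) (product S))) r))

        absurd : ⊥
        absurd =
          let (S , S-kills) = finitelyManyKill
              product∼0 = killedByAll⇒0 (product S) (S-kills (product S) (product-killed S))
          in product-survives S (Ω.trans (ev.⟦⟧-cong product∼0) ev.0#-homo)

-- Pre-Galois groups

module _ {ℓ : Level} {k : CommutativeRing ℓ ℓ} where

  embeddings : Algebra k → Algebra k → Setoid ℓ ℓ
  embeddings E Ω = record
    { Carrier       = AlgebraHom E Ω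
    ; _≈_           = λ x y → ∀ a → AlgebraHom.⟦_⟧ x a ≈ AlgebraHom.⟦_⟧ y a
    ; isEquivalence = record
      { refl  = λ a → refl
      ; sym   = λ p a → sym (p a)
      ; trans = λ p q a → trans (p a) (q a)
      }
    }
    where open Algebra Ω

  galois-isField : {M : Algebra k} → IsGaloisExtension M → IsField (Algebra.commutativeRing M)
  galois-isField g = IsFiniteFieldExtension.isField (IsGaloisExtension.isFiniteFieldExtension g)

  galois-spanned : {M : Algebra k} → IsGaloisExtension M → IsFinitelySpanned M
  galois-spanned g =
    let (n , e , spans , _) = IsFiniteFieldExtension.isFiniteDimensional
                                (IsGaloisExtension.isFiniteFieldExtension g)
    in n , e , spans

-- Aut_L(E ⊗ L) on the embeddings of E into Ω. With f = e ⊗ l, every embedding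
-- is f ∘ h ∘ (− ⊗ 1) for a unique h, and g acts by h ↦ g ∘ h.
module EmbeddingAction {ℓ : Level} (em : ExcludedMiddle ℓ) {k : CommutativeRing ℓ ℓ}
  (E L : Algebra k) (E⊗L-isGalois : IsGaloisExtension (TensorProduct.⊗-algebraʳ E L))
  (Ω : Algebra k) (Ω-isField : IsField (Algebra.commutativeRing Ω))
  (e : AlgebraHom E Ω) (l : AlgebraHom L Ω) where
  open Tensors E L public renaming (A⊗B to M)
  private
    module L = Algebra L
    module M = Algebra M
    module Ω = Algebra Ω
    module G = Group (Aut M)

  f : AlgebraHom M (along l)
  f = pairing e l

  private
    module f = AlgebraHom f

  ⟨_⟩ : Automorphism M → M.Carrier → M.Carrier
  ⟨_⟩ = Automorphism.⟦_⟧

  f-injective : ∀ {m m′} → f.⟦ m ⟧ Ω.≈ f.⟦ m′ ⟧ → m M.≈ m′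
  f-injective = fieldHom-injective f (galois-isField E⊗L-isGalois) (proj₁ Ω-isField) em

  opaque
    -- Both x ⊗ l and f are L-embeddings of the Galois extension E ⊗ L of L into Ω, hence conjugate.
    coordinate : AlgebraHom E Ω → Automorphism M
    coordinate x = proj₁ (Galois.conjugate em M E⊗L-isGalois (along l) Ω-isField f (pairing x l))

    coordinate-spec : ∀ x a → AlgebraHom.⟦_⟧ x a Ω.≈ f.⟦ ⟨ coordinate x ⟩ (a ⊗ L.1#) ⟧
    coordinate-spec x a = Ω.trans (Ω.sym (pairing-left x l a))
      (proj₂ (Galois.conjugate em M E⊗L-isGalois (along l) Ω-isField f (pairing x l)) (a ⊗ L.1#))

  -- The maps f g and f h are L-linear, so agreement on E ⊗ 1 is agreement everywhere, and f is
  -- injective.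
  determined : (g h : Automorphism M) →
    (∀ a → f.⟦ ⟨ g ⟩ (a ⊗ L.1#) ⟧ Ω.≈ f.⟦ ⟨ h ⟩ (a ⊗ L.1#) ⟧) → g G.≈ h
  determined g h p m =
    f-injective (hom-ext (f ∘ₐ automorphismHom g) (f ∘ₐ automorphismHom h) p m)

  act : Automorphism M → AlgebraHom E Ω → AlgebraHom E Ω
  act g x = restrictHom L l (f ∘ₐ automorphismHom g ∘ₐ automorphismHom (coordinate x)) ∘ₐ leftHom

  action : SimplyTransitiveAction (Aut M) (embeddings E Ω)
  action = record
    { _•_        = act
    ; •-cong     = λ {g} {h} {x} {y} p q a → f.⟦⟧-cong (M.trans
        (p (⟨ coordinate x ⟩ (a ⊗ L.1#)))
        (Automorphism.⟦⟧-cong h (determined (coordinate x) (coordinate y)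
          (λ b → Ω.trans (Ω.sym (coordinate-spec x b)) (Ω.trans (q b) (coordinate-spec y b)))
          (a ⊗ L.1#))))
    -- The coordinate of h • x is h times the coordinate of x.
    ; •-assoc    = λ g h x a → f.⟦⟧-cong (Automorphism.⟦⟧-cong g
        (determined (h G.∙ coordinate x) (coordinate (act h x))
          (coordinate-spec (act h x)) (a ⊗ L.1#)))
    ; transitive = λ x y → coordinate y G.∙ coordinate x G.⁻¹ , λ a →
        Ω.trans (f.⟦⟧-cong (Automorphism.⟦⟧-cong (coordinate y)
            (G.inverseˡ (coordinate x) (a ⊗ L.1#))))
          (Ω.sym (coordinate-spec y a))
    ; free       = λ {g} {h} x p m → M.trans
        (Automorphism.⟦⟧-cong g (M.sym (G.inverseʳ (coordinate x) m)))
        (M.trans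
          (determined (g G.∙ coordinate x) (h G.∙ coordinate x) p (⟨ coordinate x G.⁻¹ ⟩ m))
          (Automorphism.⟦⟧-cong h (G.inverseʳ (coordinate x) m)))
    }

-- For g ∈ Aut_L(E ⊗ L) amalgamate two copies α, β : Ω → Ω₂ with αf = βfg, so
-- that α(x) = β(g • x) for all embeddings x. As L′ is normal, αl′ = βl′σ for
-- some σ; thus αf′g′ = βf′h(1 ⊗ σ) with h ∈ Aut_L′(E ⊗ L′), and g conjugates g′
-- to h h₁⁻¹, where h₁ is the h belonging to g′ = 1.
module _ {ℓ : Level} (em : ExcludedMiddle ℓ) {k : CommutativeRing ℓ ℓ} (E L L′ : Algebra k)
  (E⊗L-isGalois  : IsGaloisExtension (TensorProduct.⊗-algebraʳ E L))
  (E⊗L′-isGalois : IsGaloisExtension (TensorProduct.⊗-algebraʳ E L′))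
  (L′-isGalois   : IsGaloisExtension L′)
  (Ω : Algebra k) (Ω-isField : IsField (Algebra.commutativeRing Ω)) (Ω-spanned : IsFinitelySpanned Ω)
  (e : AlgebraHom E Ω) (l : AlgebraHom L Ω) (l′ : AlgebraHom L′ Ω) where
  private
    module I  = EmbeddingAction em E L E⊗L-isGalois Ω Ω-isField e l
    module I′ = EmbeddingAction em E L′ E⊗L′-isGalois Ω Ω-isField e l′
    module L  = Algebra L
    module L′ = Algebra L′
    module Ω  = Algebra Ω
    module M′ = Algebra I′.M
    module G′ = Group (Aut I′.M)
    module f  = AlgebraHom I.f
    module f′ = AlgebraHom I′.f
    module l′ = AlgebraHom l′

  embeddingActions-normalize : Normalizes I.action I′.action
  embeddingActions-normalize g g′ = h₂ G′.∙ h₁ G′.⁻¹ , λ x a → β-injective (begin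
    β.⟦ AlgebraHom.⟦_⟧ (I.act g (I′.act g′ x)) a ⟧
      ≈⟨ α≈βg (I′.act g′ x) a ⟨
    α.⟦ f′.⟦ I′.⟨ g′ ⟩ (I′.⟨ I′.coordinate x ⟩ (a I′.⊗ L′.1#)) ⟧ ⟧
      ≈⟨ h₂-spec (I′.⟨ I′.coordinate x ⟩ (a I′.⊗ L′.1#)) ⟩
    β.⟦ f′.⟦ I′.⟨ h₂ ⟩ (sx x a) ⟧ ⟧
      ≈⟨ β.⟦⟧-cong (f′.⟦⟧-cong (Automorphism.⟦⟧-cong h₂ (G′.inverseˡ h₁ (sx x a)))) ⟨
    β.⟦ f′.⟦ I′.⟨ h₂ G′.∙ h₁ G′.⁻¹ ⟩ (I′.⟨ h₁ ⟩ (sx x a)) ⟧ ⟧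
      ≈⟨ β.⟦⟧-cong (f′.⟦⟧-cong (Automorphism.⟦⟧-cong (h₂ G′.∙ h₁ G′.⁻¹) (coordinate-gx x a))) ⟨
    β.⟦ AlgebraHom.⟦_⟧ (I′.act (h₂ G′.∙ h₁ G′.⁻¹) (I.act g x)) a ⟧ ∎)
    where
    -- The amalgam is taken over M, with Ω an M-algebra once through f and once through f g. The
    -- condition αf = βfg is then the compatibility of α and β with the structure maps.
    Ω/M Ω/gM : Algebra (Algebra.commutativeRing I.M)
    Ω/M  = along I.f
    Ω/gM = along (I.f ∘ₐ automorphismHom g)

    open Amalgam (amalgam em (galois-isField E⊗L-isGalois) Ω/M Ω/gM
      (along-spanned I.f (along-spanned l Ω-spanned)) (proj₁ Ω-isField) Ω-isField)
      using () renaming (Ω to Ω₂/M; Ω-isField to Ω₂-isField; left to α/M; right to β/M)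

    Ω₂ : Algebra k
    Ω₂ = restrictScalars I.A⊗B/k Ω₂/M

    module Ω₂ = Algebra Ω₂
    open Relation.Binary.Reasoning.Setoid Ω₂.setoid

    α β : AlgebraHom Ω Ω₂
    α = record
      { ⟦_⟧                = AlgebraHom.⟦_⟧ α/M
      ; isRingHomomorphism = AlgebraHom.isRingHomomorphism α/M
      ; preserves-ι        = λ c → Ω₂.trans
          (AlgebraHom.⟦⟧-cong α/M (Ω.sym (Ω.trans (f.preserves-ι (L.ι c)) (AlgebraHom.preserves-ι l c))))
          (AlgebraHom.preserves-ι α/M _)
      }
    β = record
      { ⟦_⟧                = AlgebraHom.⟦_⟧ β/M
      ; isRingHomomorphism = AlgebraHom.isRingHomomorphism β/M
      ; preserves-ι        = λ c → Ω₂.trans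
          (AlgebraHom.⟦⟧-cong β/M (Ω.sym (Ω.trans
            (AlgebraHom.preserves-ι (I.f ∘ₐ automorphismHom g) (L.ι c)) (AlgebraHom.preserves-ι l c))))
          (AlgebraHom.preserves-ι β/M _)
      }

    module α = AlgebraHom α
    module β = AlgebraHom β

    αf≈βfg : ∀ m → α.⟦ f.⟦ m ⟧ ⟧ Ω₂.≈ β.⟦ f.⟦ I.⟨ g ⟩ m ⟧ ⟧
    αf≈βfg m = Ω₂.trans (AlgebraHom.preserves-ι α/M m) (Ω₂.sym (AlgebraHom.preserves-ι β/M m))

    α≈βg : ∀ x a → α.⟦ AlgebraHom.⟦_⟧ x a ⟧ Ω₂.≈ β.⟦ AlgebraHom.⟦_⟧ (I.act g x) a ⟧
    α≈βg x a = Ω₂.trans (α.⟦⟧-cong (I.coordinate-spec x a)) (αf≈βfg _)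

    β-injective : ∀ {y z} → β.⟦ y ⟧ Ω₂.≈ β.⟦ z ⟧ → y Ω.≈ z
    β-injective = fieldHom-injective β Ω-isField (proj₁ Ω₂-isField) em

    σ : Automorphism L′
    σ = proj₁ (Galois.conjugate em L′ L′-isGalois Ω₂ Ω₂-isField (β ∘ₐ l′) (α ∘ₐ l′))

    αl′≈βl′σ : ∀ b → α.⟦ l′.⟦ b ⟧ ⟧ Ω₂.≈ β.⟦ l′.⟦ Automorphism.⟦_⟧ σ b ⟧ ⟧
    αl′≈βl′σ = proj₂ (Galois.conjugate em L′ L′-isGalois Ω₂ Ω₂-isField (β ∘ₐ l′) (α ∘ₐ l′))

    structure : AlgebraHom L′ I′.A⊗B/k
    structure = structureHom L′ I′.M

    -- This map is σ-semilinear over L′, so it is typed as linear into M′ with the L′-structure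
    -- twisted by σ.
    1⊗σ : AlgebraHom I′.M (along (structure ∘ₐ automorphismHom σ))
    1⊗σ = I′.pairing I′.leftHom (structure ∘ₐ automorphismHom σ)

    module 1⊗σ = AlgebraHom 1⊗σ

    βf′ : AlgebraHom I′.M (along (β ∘ₐ l′))
    βf′ = alongHom β l′ ∘ₐ I′.f

    -- Conjugacy needs two maps linear over L′ through βl′, and αf′h′ is linear through αl′ instead.
    -- Let q agree with αf′h′ on E and with βl′ on L′. Then q (1 ⊗ σ) = αf′h′ because αl′ = βl′σ,
    -- and q = βf′h by conjugacy of the L′-embeddings of M′.
    twist : (h′ : Automorphism I′.M) → ∃[ h ] ∀ m →
      α.⟦ f′.⟦ I′.⟨ h′ ⟩ m ⟧ ⟧ Ω₂.≈ β.⟦ f′.⟦ I′.⟨ h ⟩ 1⊗σ.⟦ m ⟧ ⟧ ⟧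
    twist h′ = h , λ m → Ω₂.trans
      (I′.ringHom-ext Ω₂.commutativeRing
        (AlgebraHom.isRingHomomorphism (α ∘ₐ f′h′))
        (AlgebraHom.isRingHomomorphism
          (restrictHom L′ (β ∘ₐ l′) q ∘ₐ restrictHom L′ (structure ∘ₐ automorphismHom σ) 1⊗σ))
        (λ a → Ω₂.sym (Ω₂.trans (q.⟦⟧-cong (I′.pairing-left I′.leftHom (structure ∘ₐ automorphismHom σ) a))
          (I′.pairing-left αf′h′ (β ∘ₐ l′) a)))
        (λ b → begin
          α.⟦ f′.⟦ I′.⟨ h′ ⟩ (M′.ι b) ⟧ ⟧
            ≈⟨ α.⟦⟧-cong (AlgebraHom.preserves-ι (I′.f ∘ₐ automorphismHom h′) b) ⟩
          α.⟦ l′.⟦ b ⟧ ⟧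
            ≈⟨ αl′≈βl′σ b ⟩
          β.⟦ l′.⟦ Automorphism.⟦_⟧ σ b ⟧ ⟧
            ≈⟨ q.preserves-ι _ ⟨
          q.⟦ M′.ι (Automorphism.⟦_⟧ σ b) ⟧
            ≈⟨ q.⟦⟧-cong (1⊗σ.preserves-ι b) ⟨
          q.⟦ 1⊗σ.⟦ M′.ι b ⟧ ⟧ ∎)
        m)
      (h-spec 1⊗σ.⟦ m ⟧)
      where
      f′h′ : AlgebraHom I′.A⊗B/k Ω
      f′h′ = restrictHom L′ l′ (I′.f ∘ₐ automorphismHom h′)

      αf′h′ : AlgebraHom E Ω₂
      αf′h′ = α ∘ₐ f′h′ ∘ₐ I′.leftHom

      q : AlgebraHom I′.M (along (β ∘ₐ l′))
      q = I′.pairing αf′h′ (β ∘ₐ l′)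
      module q = AlgebraHom q

      conjugation = Galois.conjugate em I′.M E⊗L′-isGalois (along (β ∘ₐ l′)) Ω₂-isField βf′ q
      h = proj₁ conjugation
      h-spec = proj₂ conjugation

    h₁ h₂ : Automorphism I′.M
    h₁ = proj₁ (twist G′.ε)
    h₂ = proj₁ (twist g′)

    h₂-spec = proj₂ (twist g′)

    -- This element depends on neither g′ nor the h found for it: the two uses of `twist` give h₁
    -- and h₂ applied to it, and so σ cancels in h₂ h₁⁻¹.
    sx : AlgebraHom E Ω → Algebra.Carrier E → M′.Carrier
    sx x a = 1⊗σ.⟦ I′.⟨ I′.coordinate x ⟩ (a I′.⊗ L′.1#) ⟧

    -- This is `twist` at the identity, read through α(x) = β(g • x); the injective map βf′ is then
    -- cancelled.
    coordinate-gx : ∀ x a →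
      I′.⟨ I′.coordinate (I.act g x) ⟩ (a I′.⊗ L′.1#) M′.≈ I′.⟨ h₁ ⟩ (sx x a)
    coordinate-gx x a = I′.f-injective (β-injective (begin
      β.⟦ f′.⟦ I′.⟨ I′.coordinate (I.act g x) ⟩ (a I′.⊗ L′.1#) ⟧ ⟧
        ≈⟨ β.⟦⟧-cong (I′.coordinate-spec (I.act g x) a) ⟨
      β.⟦ AlgebraHom.⟦_⟧ (I.act g x) a ⟧
        ≈⟨ α≈βg x a ⟨
      α.⟦ AlgebraHom.⟦_⟧ x a ⟧
        ≈⟨ α.⟦⟧-cong (I′.coordinate-spec x a) ⟩
      α.⟦ f′.⟦ I′.⟨ I′.coordinate x ⟩ (a I′.⊗ L′.1#) ⟧ ⟧
        ≈⟨ proj₂ (twist G′.ε) (I′.⟨ I′.coordinate x ⟩ (a I′.⊗ L′.1#)) ⟩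
      β.⟦ f′.⟦ I′.⟨ h₁ ⟩ (sx x a) ⟧ ⟧ ∎))

preGaloisGroups-≅ : ∀ {ℓ} → ExcludedMiddle ℓ → {k : CommutativeRing ℓ ℓ} (E : Algebra k)
  (G G′ : Group ℓ ℓ) → IsSimple G → IsPreGaloisGroup E G → IsPreGaloisGroup E G′ → G′ ≅ G
preGaloisGroups-≅ em {k} E G G′ G-simple P P′ =
  ≅-trans G′ (Aut M′) G (≅-sym (Aut M′) G′ P′.Aut≅G)
    (≅-trans (Aut M′) (Aut M) G AutM′≅AutM P.Aut≅G)
  where
  module P  = IsPreGaloisGroup P
  module P′ = IsPreGaloisGroup P′
  open Tensors E P.L using (leftHom) renaming (A⊗B to M; A⊗B/k to M/k)
  M′ = TensorProduct.⊗-algebraʳ E P′.L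

  k-isField : IsField k
  k-isField = IsFiniteFieldExtension.base-isField P.isFiniteFieldExtension

  -- The field E ⊗ L already contains E and L, so a single amalgam with L′ receives all three; e and
  -- l are the restrictions of m to the two tensor factors.
  open Amalgam (amalgam em k-isField P′.L M/k (galois-spanned P′.L-isGalois)
    (proj₁ (galois-isField P′.L-isGalois)) (galois-isField P.E⊗L-isGalois))
    using (Ω; Ω-isField; spanned) renaming (left to l′; right to m)

  e : AlgebraHom E Ω
  e = m ∘ₐ leftHom

  l : AlgebraHom P.L Ω
  l = m ∘ₐ structureHom P.L M

  Ω-spanned : IsFinitelySpanned Ω
  Ω-spanned = spannedVia m
    (tower-spanned {A = P.L} M (galois-spanned P.L-isGalois) (galois-spanned P.E⊗L-isGalois)) spanned

  AutM′≅AutM : Aut M′ ≅ Aut M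
  AutM′≅AutM = simplyTransitive⇒≅ {G = Aut M} {H = Aut M′} {X = embeddings E Ω}
    (IsSimple-resp-≅ G (Aut M) (≅-sym (Aut M) G P.Aut≅G) G-simple) e
    (EmbeddingAction.action em E P.L P.E⊗L-isGalois Ω Ω-isField e l)
    (EmbeddingAction.action em E P′.L P′.E⊗L-isGalois Ω Ω-isField e l′)
    (embeddingActions-normalize em E P.L P′.L P.E⊗L-isGalois P′.E⊗L-isGalois P′.L-isGalois
      Ω Ω-isField Ω-spanned e l l′)
    (embeddingActions-normalize em E P′.L P.L P′.E⊗L-isGalois P.E⊗L-isGalois P.L-isGalois
      Ω Ω-isField Ω-spanned e l′ l)

proposition2p18 : (∀ {a : Level} → ExcludedMiddle a) →
    ∀ {ℓ : Level} (G : Group ℓ ℓ) → IsFinite G → IsSimple G →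
    ((Γ : Group ℓ ℓ) (U N : Subgroup Γ) →
    IsNormalComplement U N → Subgroup.group N ≅ G →
    (N′ : Subgroup Γ) → IsNormalComplement U N′ → Subgroup.group N′ ≅ G)
    ×
    ((k : CommutativeRing ℓ ℓ) (E : Algebra k) →
    IsPreGaloisGroup E G →
    (G′ : Group ℓ ℓ) → IsPreGaloisGroup E G′ → G′ ≅ G)
proposition2p18 em G _ G-simple =
  (λ Γ U N → normalComplements-≅ G-simple U N) ,
  (λ k E P G′ P′ → preGaloisGroups-≅ em E G G′ G-simple P P′)
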